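{- Let $G = (V,E)$ be a distance regular graph with $n = \operatorname{diam} G$. Let $\theta_0 > \theta_1 > \cdots > \theta_n$ be the distinct eigenvalues of its adjacency matrix $A_1$, and let $v_i$ ($0 \le i \le n$) be the univariate polynomial of degree $i$ with $A_i = v_i(A_1)$, where $A_i$ is the $i$-th adjacency (distance-$i$) matrix of $G$. Then \[ c_2(G)^2 \;\geq\; \frac{n^2\, v_n(\theta_0)}{v_1(\theta_0)} \; \min_{j \in \{1,\ldots,n\}} \left\{ \frac{v_1(\theta_0) - v_1(\theta_j)}{v_n(\theta_0) - v_n(\theta_j)} \right\}. \]
   Context: Graphs are finite and undirected: $G=(V,E)$ with $V$ a finite vertex set and $E \subseteq \binom{V}{2}$ a set of two-element subsets of $V$. For $x,y\in V$, $d(x,y)$ is the length of a shortest path between $x$ and $y$ ($\infty$ if there is none), and $\operatorname{diam} G = \max_{x,y\in V} d(x,y)$. $G$ is connected if its diameter is finite; then $(V,d)$ is a finite metric space. Distortion: for a finite metric space $(X,d)$ with $N$ elements, an embedding $\varrho : X \to \mathbb{R}^N$ (Euclidean norm $\|\cdot\|$) has distortion $D$ if $d(x,y) \le \|\varrho(x)-\varrho(y)\| \le D\, d(x,y)$ for all $x,y\in X$. The least distortion $c_2(X,d)$ is the least $D$ for which such an embedding exists. For a connected graph $G$ with shortest path metric $d$, $c_2(G) := c_2(V,d)$. A connected graph $G$ is distance regular if there are constants $a_i,b_i,c_i$ ($0\le i\le \operatorname{diam} G$) such that for all $x,y \in V$ with $d(x,y)=i$: $a_i = |\{z\in V : d(x,z)=1,\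 d(z,y)=i\}|$, $b_i = |\{z\in V : d(x,z)=1,\ d(z,y)=i+1\}|$, $c_i = |\{z\in V : d(x,z)=1,\ d(z,y)=i-1\}|$. The $i$-th adjacency matrix $A_i\in\{0,1\}^{V\times V}$ has $(A_i)_{xy}=1$ if $d(x,y)=i$ and $0$ otherwise. For a distance regular graph the relation $A_1A_i = c_{i+1}A_{i+1}+a_iA_i+b_{i-1}A_{i-1}$ holds, so $A_i = v_i(A_1)$ for a univariate polynomial $v_i$ of degree $i$; $A_1$ has exactly $\operatorname{diam} G + 1$ distinct eigenvalues. -}

module Defs where

open import Level using (Level; 0ℓ; _⊔_) renaming (suc to lsuc)
open import Data.Bool.Base using (if_then_else_)
open import Data.Empty using (⊥-elim)
open import Data.Fin.Base as Fin using (Fin; toℕ)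
import Data.Fin.Properties as Fin
open import Data.Nat.Base as ℕ using (ℕ; zero; suc; z≤n; s≤s)
import Data.Nat.Properties as ℕ
open import Data.Product.Base using (Σ; ∃; _×_; _,_; proj₁; proj₂)
open import Data.Sum.Base using (_⊎_)
open import Data.Vec.Base using (allFin; count)
open import Data.Vec.Functional using (Vector; foldr)
open import Function.Bundles using (_⇔_)
open import Relation.Binary.Core using (Rel)
import Relation.Binary.Definitions as B
open import Relation.Binary.PropositionalEquality.Core using (_≡_; refl)
open import Relation.Binary.Structures using (IsStrictPartialOrder)
open import Relation.Nullary.Decidable.Core using (Dec; yes; no; does; map′; _×-dec_)
open import Relation.Nullary.Negation.Core using (¬_)
open import Relation.Unary using (Pred; Decidable)
open import Algebra.Apartness.Bundles using (HeytingField; HeytingCommutativeRing)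
open import Algebra.Bundles using (CommutativeRing; Semiring)
import Algebra.Definitions.RawSemiring as RawSemiringDefs

------------------------------------------------------------------------
-- Graphs

record Graph (N : ℕ) : Set₁ where
  infix 4 _~_ _~?_
  field
    _~_      : Rel (Fin N) 0ℓ
    _~?_     : B.Decidable _~_
    ~-sym    : B.Symmetric _~_
    ~-irrefl : B.Irreflexive _≡_ _~_

module _ {N : ℕ} (G : Graph N) where
  open Graph G

  infixr 5 _∷_

  -- Vertices may repeat; a shortest walk is automatically a path, so
  -- repetitions do not affect distances.
  data Walk : ℕ → Fin N → Fin N → Set where
    []  : ∀ {x} → Walk 0 x x
    _∷_ : ∀ {k x y z} → x ~ z → Walk k z y → Walk (suc k) x y

  walk? : ∀ k x y → Dec (Walk k x y)
  walk? zero    x y = map′ (λ { refl → [] }) (λ { [] → refl }) (x Fin.≟ y)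
  walk? (suc k) x y = map′ (λ { (_ , e , w) → e ∷ w }) (λ { (e ∷ w) → _ , e , w })
    (Fin.any? (λ z → (x ~? z) ×-dec walk? k z y))

  -- As the vertex set is finite, this says exactly that the diameter is finite.
  Connected : Set
  Connected = ∀ x y → ∃ λ k → Walk k x y

least : ∀ {p} {P : Pred ℕ p} → Decidable P → ∀ k → P k →
        ∃ λ l → P l × (∀ m → P m → l ℕ.≤ m)
least P? zero    p = 0 , p , λ _ _ → z≤n
least P? (suc k) p with P? 0
... | yes p₀ = 0 , p₀ , λ _ _ → z≤n
... | no ¬p₀ with least (λ m → P? (suc m)) k p
...   | l , q , min = suc l , q ,
        λ { zero p₀ → ⊥-elim (¬p₀ p₀) ; (suc m) pm → s≤s (min m pm) }

module _ {N : ℕ} (G : Graph N) (conn : Connected G) where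

  dist : Fin N → Fin N → ℕ
  dist x y = let k , w = conn x y in proj₁ (least (λ m → walk? G m x y) k w)

  diam : ℕ
  diam = foldr ℕ._⊔_ 0 λ x → foldr ℕ._⊔_ 0 λ y → dist x y

  -- The constants are indexed by all of ℕ, but only the values at indices
  -- up to the diameter are constrained.  In c-count, the condition
  -- d(z,y) = i − 1 is written additively, so nothing is counted when i = 0.
  record DistanceRegular : Set where
    field
      a b c   : ℕ → ℕ
      a-count : ∀ x y → a (dist x y) ≡
        count (λ z → (dist x z ℕ.≟ 1) ×-dec (dist z y ℕ.≟ dist x y)) (allFin N)
      b-count : ∀ x y → b (dist x y) ≡
        count (λ z → (dist x z ℕ.≟ 1) ×-dec (dist z y ℕ.≟ suc (dist x y))) (allFin N)
      c-count : ∀ x y → c (dist x y) ≡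
        count (λ z → (dist x z ℕ.≟ 1) ×-dec (suc (dist z y) ℕ.≟ dist x y)) (allFin N)

------------------------------------------------------------------------
-- The real numbers

-- The reals are axiomatised as a Cauchy complete Archimedean ordered field.
-- Classically this determines ℝ up to unique isomorphism; the axioms are
-- phrased so that constructively defined reals satisfy them as well.
record Reals (c ℓ₁ ℓ₂ : Level) : Set (lsuc (c ⊔ ℓ₁ ⊔ ℓ₂)) where
  infix 4 _<_ _≤_

  field
    heytingField : HeytingField c ℓ₁ ℓ₂

  open HeytingField heytingField public

  commutativeRing : CommutativeRing c ℓ₁
  commutativeRing = HeytingCommutativeRing.commutativeRing heytingCommutativeRing

  open RawSemiringDefs (Semiring.rawSemiring (CommutativeRing.semiring commutativeRing)) public
    using (sum; _^_) renaming (_×_ to _·_)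

  fromℕ : ℕ → Carrier
  fromℕ k = k · 1#

  field
    _<_                  : Rel Carrier ℓ₂
    isStrictPartialOrder : IsStrictPartialOrder _≈_ _<_
    #⇒<⊎>                : ∀ {x y} → x # y → x < y ⊎ y < x
    <⇒#                  : ∀ {x y} → x < y → x # y
    +-monoˡ-<            : ∀ {x y} z → x < y → x + z < y + z
    *-pos                : ∀ {x y} → 0# < x → 0# < y → 0# < x * y
    archimedean          : ∀ x → ∃ λ k → x < fromℕ k

  _≤_ : Rel Carrier ℓ₂
  x ≤ y = ¬ (y < x)

  Within : Carrier → Rel Carrier ℓ₂
  Within ε x y = (x - y < ε) × (y - x < ε)

  Cauchy : (ℕ → Carrier) → Set (c ⊔ ℓ₂)
  Cauchy s = ∀ ε → 0# < ε → ∃ λ K → ∀ i j → K ℕ.≤ i → K ℕ.≤ j → Within ε (s i) (s j)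

  ConvergesTo : (ℕ → Carrier) → Carrier → Set (c ⊔ ℓ₂)
  ConvergesTo s x = ∀ ε → 0# < ε → ∃ λ K → ∀ i → K ℕ.≤ i → Within ε (s i) x

  field
    complete : ∀ s → Cauchy s → ∃ (ConvergesTo s)

module OverReals {c ℓ₁ ℓ₂} (ℝ : Reals c ℓ₁ ℓ₂) where
  open Reals ℝ public

  -- #⇒invertible provides the inverse of y - 0#.
  quotient : (x y : Carrier) → y # 0# → Carrier
  quotient x y y#0 = x * proj₁ (#⇒invertible y#0)

  IsMinimum : ∀ {p} → Pred Carrier p → Carrier → Set (c ⊔ ℓ₂ ⊔ p)
  IsMinimum P m = P m × (∀ x → P x → m ≤ x)

  ----------------------------------------------------------------------
  -- Distortion

  IsNorm : ∀ {N} → Vector Carrier N → Carrier → Set (ℓ₁ ⊔ ℓ₂)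
  IsNorm u r = 0# ≤ r × r ^ 2 ≈ sum (λ i → u i ^ 2)

  EmbedsWithDistortion : ∀ {N} → (Fin N → Fin N → Carrier) → Carrier → Set (c ⊔ ℓ₁ ⊔ ℓ₂)
  EmbedsWithDistortion {N} d D =
    Σ (Fin N → Vector Carrier N) λ ϱ → ∀ x y →
      ∃ λ r → IsNorm (λ i → ϱ x i - ϱ y i) r × d x y ≤ r × r ≤ D * d x y

  IsLeastDistortion : ∀ {N} → (Fin N → Fin N → Carrier) → Carrier → Set (c ⊔ ℓ₁ ⊔ ℓ₂)
  IsLeastDistortion d = IsMinimum (EmbedsWithDistortion d)

  Is-c₂ : ∀ {N} (G : Graph N) → Connected G → Carrier → Set (c ⊔ ℓ₁ ⊔ ℓ₂)
  Is-c₂ G conn = IsLeastDistortion (λ x y → fromℕ (dist G conn x y))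

  ----------------------------------------------------------------------
  -- Matrices and polynomials

  Matrix : ℕ → Set c
  Matrix N = Fin N → Fin N → Carrier

  identity : ∀ {N} → Matrix N
  identity x y = if does (x Fin.≟ y) then 1# else 0#

  _⊗_ : ∀ {N} → Matrix N → Matrix N → Matrix N
  (L ⊗ M) x y = sum λ z → L x z * M z y

  power : ∀ {N} → Matrix N → ℕ → Matrix N
  power M zero    = identity
  power M (suc k) = M ⊗ power M k

  IsEigenvalue : ∀ {N} → Matrix N → Carrier → Set (c ⊔ ℓ₁ ⊔ ℓ₂)
  IsEigenvalue {N} M t = Σ (Vector Carrier N) λ u →
    (∃ λ x → u x # 0#) × (∀ x → sum (λ y → M x y * u y) ≈ t * u x)

  -- The coefficients of a polynomial of formal degree i, constant term first.
  Poly : ℕ → Set c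
  Poly i = Vector Carrier (suc i)

  HasDegree : ∀ i → Poly i → Set ℓ₁
  HasDegree i p = ¬ (p (Fin.fromℕ i) ≈ 0#)

  eval : ∀ {i} → Poly i → Carrier → Carrier
  eval p t = sum λ k → p k * t ^ toℕ k

  evalMatrix : ∀ {i N} → Poly i → Matrix N → Matrix N
  evalMatrix p M x y = sum λ k → p k * power M (toℕ k) x y

  distanceMatrix : ∀ {N} (G : Graph N) → Connected G → ℕ → Matrix N
  distanceMatrix G conn i x y = if does (dist G conn x y ℕ.≟ i) then 1# else 0#

  ----------------------------------------------------------------------
  -- Spectral data of a distance regular graph

  record DistinctEigenvalues {N} (M : Matrix N) {k} (θ : Fin k → Carrier)
         : Set (c ⊔ ℓ₁ ⊔ ℓ₂) where
    field
      decreasing  : ∀ {i j} → i Fin.< j → θ j < θ i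
      eigenvalues : ∀ t → IsEigenvalue M t ⇔ (∃ λ j → t ≈ θ j)

  -- Only the members v i with i at most the diameter are constrained.
  IsDistancePolynomials : ∀ {N} (G : Graph N) → Connected G → (∀ i → Poly i) → Set ℓ₁
  IsDistancePolynomials G conn v = ∀ i → i ℕ.≤ diam G conn →
    HasDegree i (v i) ×
    (∀ x y → distanceMatrix G conn i x y ≈ evalMatrix (v i) (distanceMatrix G conn 1) x y)

  -- The values of (v₁(θ₀) − v₁(θⱼ)) / (vₙ(θ₀) − vₙ(θⱼ)) for 1 ≤ j ≤ n.  The
  -- denominator can vanish (for instance in the hypercube with j = 2 ≤ n); the
  -- ratio is then +∞ and does not compete for the minimum.
  Ratio : ∀ n → (∀ i → Poly i) → (Fin (suc n) → Carrier) → Pred Carrier (ℓ₁ ⊔ ℓ₂)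
  Ratio n v θ q = ∃ λ (j : Fin n) →
    let num = eval (v 1) (θ Fin.zero) - eval (v 1) (θ (Fin.suc j))
        den = eval (v n) (θ Fin.zero) - eval (v n) (θ (Fin.suc j))
    in Σ (den # 0#) λ den#0 → q ≈ quotient num den den#0

-- Let k = θ₀ be the degree.  As Σᵢ vᵢ(A₁) is the all-ones matrix J and
-- (A₁ − k) J = 0, the polynomial (t − k) Σᵢ vᵢ(t), of degree n + 1, annihilates A₁.
-- Its roots are the n + 1 distinct eigenvalues, so every vector is a sum of
-- eigenvectors of A₁, which are pairwise orthogonal.  On the θⱼ-eigenvectors the
-- Laplacian of W = A₁ − μ Aₙ acts as (v₁(θ₀) − v₁(θⱼ)) − μ (vₙ(θ₀) − vₙ(θⱼ)), which
-- is nonnegative by minimality of μ.  Hence for the coordinates of an embedding ϱ,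
--   μ Σ_{d(x,y) = n} ‖ϱ(x) − ϱ(y)‖² ≤ Σ_{d(x,y) = 1} ‖ϱ(x) − ϱ(y)‖².
-- With distortion D, the left side is at least μ N vₙ(θ₀) n² and the right side
-- at most N v₁(θ₀) D².
module Submission where

-- The reals may be constructive ones: the order is not decidable, and a number merely known to
-- differ from zero cannot be inverted. As `x ≤ y` is a negation, its proofs may still split by
-- trichotomy. Inverses are taken only of numbers apart from zero, such as differences of the
-- strictly decreasing `θ j`. The decomposition into eigenvectors is built within these limits by
-- dividing out one root at a time. There are exactly as many roots as the degree, so the division
-- ends in a constant, and `HasDegree` says only that this constant is not zero, which suffices
-- there.
--
-- That k is the largest eigenvalue, and that all gaps v_i(θ₀) - v_i(θⱼ) are nonnegative, follow
-- from one comparison of an eigenvalue with the row sum of a nonnegative symmetric matrix. A gap in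
-- a denominator may vanish, and then minimality of μ says nothing about that j; nonnegativity of
-- the other gap takes its place.

open import Defs
open import Level using (_⊔_)
open import Algebra.Bundles using (CommutativeRing)
import Algebra.Properties.AbelianGroup as AbelianGroupProperties
import Algebra.Properties.CommutativeSemigroup as CommutativeSemigroupProperties
import Algebra.Properties.Group as GroupProperties
import Algebra.Properties.Ring as RingProperties
import Algebra.Properties.Semiring.Mult as SemiringMult
import Algebra.Properties.Semiring.Sum as SemiringSum
import Algebra.Apartness.Properties.HeytingCommutativeRing as HeytingProperties
import Algebra.Solver.Ring as RingSolver
open import Algebra.Solver.Ring.AlmostCommutativeRing
  using (fromCommutativeRing; _-Raw-AlmostCommutative⟶_)
open import Algebra.Bundles.Raw using (RawRing)
open import Data.Bool.Base using (Bool; true; false; if_then_else_)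
open import Data.Empty using (⊥; ⊥-elim)
open import Data.Fin.Base as Fin using (Fin)
import Data.Fin.Properties as Fin
open import Data.Maybe.Base using (Maybe; just; nothing)
open import Data.Nat.Base as ℕ using (ℕ; zero; suc)
import Data.Nat.Properties as ℕ
open import Data.Product.Base using (Σ; ∃; _,_; proj₁; proj₂) renaming (_×_ to _×ᵖ_)
open import Data.Sum.Base using (inj₁; inj₂; [_,_]′)
open import Data.Vec.Base as Vec using (count; allFin)
import Data.Vec.Functional as VF
open import Data.Vec.Functional using (Vector; foldr)
open import Function.Base using (_∘_; id; case_of_)
open import Function.Bundles using (Equivalence; mk⇔)
open import Relation.Binary.Definitions using (tri<; tri≈; tri>)
open import Relation.Binary.Structures using (IsStrictPartialOrder)
import Relation.Binary.Reasoning.Setoid as ≈-Reasoning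
open import Relation.Binary.PropositionalEquality.Core as ≡ using (_≡_; _≢_)
open import Relation.Nullary.Decidable using (Dec; yes; no; does; dec-true; dec-false; does-⇔; _×-dec_)
open import Relation.Nullary.Negation.Core using (¬_; contradiction)

-- The coefficients are formal differences of natural numbers, so that the
-- solver can recognise cancellation in an arbitrary commutative ring.
module DifferenceSolver {c ℓ} (R : CommutativeRing c ℓ) where
  open CommutativeRing R
  open SemiringMult semiring using (_×_; ×-homo-+; ×1-homo-*)
  open RingProperties ring using (-‿distribˡ-*; -‿distribʳ-*)
  open GroupProperties +-group using (∙-cancelʳ)
  open AbelianGroupProperties +-abelianGroup using (⁻¹-∙-comm; ⁻¹-anti-homo‿-)
  open CommutativeSemigroupProperties +-commutativeSemigroup using (interchange)
  open ≈-Reasoning setoid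

  -- The solver compares normal forms syntactically, so the results of the
  -- operations are reduced to the form (m , 0) or (0 , m).
  canonical : ℕ → ℕ → ℕ ×ᵖ ℕ
  canonical a b = a ℕ.∸ b , b ℕ.∸ a

  differences : RawRing _ _
  differences = record
    { Carrier = ℕ ×ᵖ ℕ
    ; _≈_ = _≡_
    ; _+_ = λ (a , b) (c , d) → canonical (a ℕ.+ c) (b ℕ.+ d)
    ; _*_ = λ (a , b) (c , d) → canonical (a ℕ.* c ℕ.+ b ℕ.* d) (a ℕ.* d ℕ.+ b ℕ.* c)
    ; -_  = λ (a , b) → b , a
    ; 0#  = 0 , 0
    ; 1#  = 1 , 0
    }

  difference : ℕ ×ᵖ ℕ → Carrier
  difference (a , b) = a × 1# - b × 1#

  +-interchange : ∀ a b c d → (a + b) - (c + d) ≈ (a - c) + (b - d)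
  +-interchange a b c d = trans (+-congˡ (sym (⁻¹-∙-comm c d))) (interchange a b (- c) (- d))

  *-difference : ∀ a b c d → (a * c + b * d) - (a * d + b * c) ≈ (a - b) * (c - d)
  *-difference a b c d = begin
    (a * c + b * d) - (a * d + b * c)             ≈⟨ +-interchange _ _ _ _ ⟩
    (a * c - a * d) + (b * d - b * c)             ≈⟨ +-cong (lemma a c d) (lemma b d c) ⟩
    a * (c - d) + b * (d - c)                     ≈⟨ +-congˡ (*-congˡ (⁻¹-anti-homo‿- c d)) ⟨
    a * (c - d) + b * - (c - d)                   ≈⟨ +-congˡ (trans (sym (-‿distribʳ-* _ _)) (-‿distribˡ-* _ _)) ⟩
    a * (c - d) + - b * (c - d)                   ≈⟨ distribʳ _ _ _ ⟨
    (a - b) * (c - d)                             ∎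
    where
    lemma : ∀ x y z → x * y - x * z ≈ x * (y - z)
    lemma x y z = trans (+-congˡ (-‿distribʳ-* x z)) (sym (distribˡ x y (- z)))

  difference-≈ : ∀ {a b c d} → a + d ≈ c + b → a - b ≈ c - d
  difference-≈ {a} {b} {c} {d} eq = ∙-cancelʳ (b + d) _ _ (begin
    (a - b) + (b + d)   ≈⟨ interchange _ _ _ _ ⟩
    (a + b) + (- b + d) ≈⟨ +-congʳ (+-comm a b) ⟩
    (b + a) + (- b + d) ≈⟨ interchange _ _ _ _ ⟩
    (b - b) + (a + d)   ≈⟨ +-cong (trans (-‿inverseʳ b) (sym (-‿inverseʳ d))) eq ⟩
    (d - d) + (c + b)   ≈⟨ interchange _ _ _ _ ⟩
    (d + c) + (- d + b) ≈⟨ +-congʳ (+-comm d c) ⟩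
    (c + d) + (- d + b) ≈⟨ interchange _ _ _ _ ⟩
    (c - d) + (d + b)   ≈⟨ +-congˡ (+-comm d b) ⟩
    (c - d) + (b + d)   ∎)

  difference-≡ : ∀ {a b c d} → a ℕ.+ d ≡ c ℕ.+ b → difference (a , b) ≈ difference (c , d)
  difference-≡ {a} {b} {c} {d} eq = difference-≈ (trans (sym (×-homo-+ 1# a d))
    (trans (reflexive (≡.cong (_× 1#) eq)) (×-homo-+ 1# c b)))

  difference-canonical : ∀ a b → difference (canonical a b) ≈ difference (a , b)
  difference-canonical a b = difference-≡ {a ℕ.∸ b} {b ℕ.∸ a} (∸-+ a b)
    where
    ∸-+ : ∀ a b → a ℕ.∸ b ℕ.+ b ≡ a ℕ.+ (b ℕ.∸ a)
    ∸-+ zero    zero    = ≡.refl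
    ∸-+ zero    (suc b) = ≡.refl
    ∸-+ (suc a) zero    = ≡.refl
    ∸-+ (suc a) (suc b) = ≡.trans (ℕ.+-suc (a ℕ.∸ b) b) (≡.cong suc (∸-+ a b))

  morphism : differences -Raw-AlmostCommutative⟶ fromCommutativeRing R
  morphism = record
    { ⟦_⟧    = difference
    ; +-homo = λ (a , b) (c , d) → trans (difference-canonical (a ℕ.+ c) (b ℕ.+ d)) (trans
        (+-cong (×-homo-+ 1# a c) (-‿cong (×-homo-+ 1# b d))) (+-interchange _ _ _ _))
    ; *-homo = λ (a , b) (c , d) → trans (difference-canonical (a ℕ.* c ℕ.+ b ℕ.* d) (a ℕ.* d ℕ.+ b ℕ.* c)) (trans
        (+-cong (products a c b d) (-‿cong (products a d b c))) (*-difference _ _ _ _))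
    ; -‿homo = λ (a , b) → sym (⁻¹-anti-homo‿- _ _)
    ; 0-homo = -‿inverseʳ 0#
    ; 1-homo = begin
        (1# + 0#) - 0# ≈⟨ +-assoc _ _ _ ⟩
        1# + (0# - 0#) ≈⟨ +-congˡ (-‿inverseʳ 0#) ⟩
        1# + 0#        ≈⟨ +-identityʳ 1# ⟩
        1#             ∎
    }
    where
    products : ∀ a b c d → (a ℕ.* b ℕ.+ c ℕ.* d) × 1# ≈ (a × 1#) * (b × 1#) + (c × 1#) * (d × 1#)
    products a b c d = trans (×-homo-+ 1# (a ℕ.* b) (c ℕ.* d)) (+-cong (×1-homo-* a b) (×1-homo-* c d))

  coefficient≟ : ∀ p q → Maybe (difference p ≈ difference q)
  coefficient≟ (a , b) (c , d) with a ℕ.+ d ℕ.≟ c ℕ.+ b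
  ... | no  _  = nothing
  ... | yes eq = just (difference-≡ {a} {b} eq)

  open RingSolver differences (fromCommutativeRing R) morphism coefficient≟ public
    using (solve; _:=_; _:+_; _:*_; _:-_; :-_; _:^_)

-- Graph distance

module _ {N : ℕ} {G : Graph N} where
  open Graph G

  snoc : ∀ {k x y z} → Walk G k x y → y ~ z → Walk G (suc k) x z
  snoc []      e = e ∷ []
  snoc (f ∷ w) e = f ∷ snoc w e

  reverse : ∀ {k x y} → Walk G k x y → Walk G k y x
  reverse []      = []
  reverse (e ∷ w) = snoc (reverse w) (~-sym e)

f≤foldr-⊔ : ∀ {m} (f : Fin m → ℕ) i → f i ℕ.≤ foldr ℕ._⊔_ 0 f
f≤foldr-⊔ f Fin.zero    = ℕ.m≤m⊔n _ _
f≤foldr-⊔ f (Fin.suc i) = ℕ.≤-trans (f≤foldr-⊔ (f ∘ Fin.suc) i) (ℕ.m≤n⊔m _ _)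

1≤foldr-⊔⇒∃ : ∀ {m} (f : Fin m → ℕ) → 1 ℕ.≤ foldr ℕ._⊔_ 0 f → ∃ λ i → 1 ℕ.≤ f i
1≤foldr-⊔⇒∃ {zero}  f ()
1≤foldr-⊔⇒∃ {suc m} f 1≤max with ℕ.⊔-sel (f Fin.zero) (foldr ℕ._⊔_ 0 (f ∘ Fin.suc))
... | inj₁ eq = Fin.zero , ≡.subst (1 ℕ.≤_) eq 1≤max
... | inj₂ eq with 1≤foldr-⊔⇒∃ (f ∘ Fin.suc) (≡.subst (1 ℕ.≤_) eq 1≤max)
...   | i , 1≤fi = Fin.suc i , 1≤fi

module _ {N : ℕ} (G : Graph N) (conn : Connected G) where
  open Graph G

  shortest : ∀ x y → Walk G (dist G conn x y) x y
  shortest x y = let k , w = conn x y in proj₁ (proj₂ (least (λ m → walk? G m x y) k w))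

  dist≤ : ∀ {k x y} → Walk G k x y → dist G conn x y ℕ.≤ k
  dist≤ {k} {x} {y} w′ = let k₀ , w = conn x y in
    proj₂ (proj₂ (least (λ m → walk? G m x y) k₀ w)) k w′

  dist-sym : ∀ x y → dist G conn x y ≡ dist G conn y x
  dist-sym x y = ℕ.≤-antisym (dist≤ (reverse (shortest y x))) (dist≤ (reverse (shortest x y)))

  dist-refl : ∀ x → dist G conn x x ≡ 0
  dist-refl x = ℕ.n≤0⇒n≡0 (dist≤ [])

  dist≤diam : ∀ x y → dist G conn x y ℕ.≤ diam G conn
  dist≤diam x y = ℕ.≤-trans (f≤foldr-⊔ (dist G conn x) y)
    (f≤foldr-⊔ (λ x → foldr ℕ._⊔_ 0 λ y → dist G conn x y) x)

  dist-adjacent : ∀ {x z} → x ~ z → dist G conn x z ≡ 1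
  dist-adjacent {x} {z} e with dist G conn x z | dist≤ (e ∷ []) | shortest x z
  ... | 0 | _ | []            = contradiction e (~-irrefl ≡.refl)
  ... | 1 | _ | _             = ≡.refl
  ... | suc (suc _) | ℕ.s≤s () | _

  -- A positive distance has a shortest walk with a first edge. The vertex `x` also witnesses that
  -- the graph is not empty, which later excludes an empty sum over the vertices.
  ∃-adjacent : 1 ℕ.≤ diam G conn → ∃ λ x → ∃ λ z → dist G conn x z ≡ 1
  ∃-adjacent 1≤n with 1≤foldr-⊔⇒∃ (λ x → foldr ℕ._⊔_ 0 λ y → dist G conn x y) 1≤n
  ... | x , 1≤x with 1≤foldr-⊔⇒∃ (dist G conn x) 1≤x
  ...   | y , 1≤d with dist G conn x y | shortest x y
  ...     | suc _ | e ∷ _ = x , _ , dist-adjacent e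

-- Order, sums and linear algebra over the reals

module RealAlgebra {c ℓ₁ ℓ₂} (ℝ : Reals c ℓ₁ ℓ₂) where
  open OverReals ℝ
  open CommutativeRing commutativeRing public using (ring; semiring; +-group)
  open RingProperties ring public using (-0#≈0#; x[y-z]≈xy-xz)
  open GroupProperties +-group public using (x∙y⁻¹≈ε⇒x≈y)
  open SemiringSum semiring public
    using (sum-cong-≋; sum-remove; sum-replicate-zero; ∑-distrib-+; ∑-comm; *-distribˡ-sum; *-distribʳ-sum)
  open HeytingProperties heytingCommutativeRing public using (1#0; x#0y#0→xy#0; x-0≈x)
  open DifferenceSolver commutativeRing public
    using (solve; _:=_; _:+_; _:*_; _:-_; :-_; _:^_)
  open ≈-Reasoning setoid
  open IsStrictPartialOrder isStrictPartialOrder public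
    using () renaming (irrefl to <-irrefl; trans to <-trans; <-respʳ-≈ to <-respʳ; <-respˡ-≈ to <-respˡ)

  -- Every inequality x ≤ y is a negation, so excluded middle may be used to prove it.
  by-trichotomy : ∀ x y → ¬ x < y → ¬ x ≈ y → ¬ y < x → ⊥
  by-trichotomy x y x≮y x≉y y≮x = x≉y (proj₁ (tight x y) ([ x≮y , y≮x ]′ ∘ #⇒<⊎>))

  ≤-respʳ : ∀ {x y z} → y ≈ z → x ≤ y → x ≤ z
  ≤-respʳ y≈z x≤y z<x = x≤y (<-respˡ (sym y≈z) z<x)

  <⇒≤ : ∀ {x y} → x < y → x ≤ y
  <⇒≤ x<y y<x = <-irrefl refl (<-trans x<y y<x)

  ≤-refl : ∀ {x} → x ≤ x
  ≤-refl = <-irrefl refl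

  x<0⇒0<-x : ∀ {x} → x < 0# → 0# < - x
  x<0⇒0<-x {x} x<0 = <-respˡ (-‿inverseʳ x) (<-respʳ (+-identityˡ (- x)) (+-monoˡ-< (- x) x<0))

  0<x⇒-x<0 : ∀ {x} → 0# < x → - x < 0#
  0<x⇒-x<0 {x} 0<x = <-respʳ (-‿inverseʳ x) (<-respˡ (+-identityˡ (- x)) (+-monoˡ-< (- x) 0<x))

  x<y⇒x-y<0 : ∀ {x y} → x < y → x - y < 0#
  x<y⇒x-y<0 {x} {y} x<y = <-respʳ (-‿inverseʳ y) (+-monoˡ-< (- y) x<y)

  x≤y⇒0≤y-x : ∀ {x y} → x ≤ y → 0# ≤ y - x
  x≤y⇒0≤y-x {x} {y} x≤y y-x<0 = x≤y (<-respˡ (solve 2 (λ x y → (y :- x) :+ x := y) refl x y)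
    (<-respʳ (+-identityˡ x) (+-monoˡ-< x y-x<0)))

  0≤y-x⇒x≤y : ∀ {x y} → 0# ≤ y - x → x ≤ y
  0≤y-x⇒x≤y 0≤y-x y<x = 0≤y-x (x<y⇒x-y<0 y<x)

  0≤x∧0≤-x⇒x≈0 : ∀ {x} → 0# ≤ x → 0# ≤ - x → x ≈ 0#
  0≤x∧0≤-x⇒x≈0 {x} 0≤x 0≤-x = proj₁ (tight x 0#) ([ 0≤x , 0≤-x ∘ 0<x⇒-x<0 ]′ ∘ #⇒<⊎>)

  0≤x+y : ∀ {x y} → 0# ≤ x → 0# ≤ y → 0# ≤ x + y
  0≤x+y {x} {y} 0≤x 0≤y x+y<0 = by-trichotomy 0# x
    (λ 0<x → 0≤y (<-trans (<-respˡ (+-identityˡ y) (+-monoˡ-< y 0<x)) x+y<0))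
    (λ 0≈x → 0≤y (<-respˡ (trans (+-congʳ (sym 0≈x)) (+-identityˡ y)) x+y<0))
    0≤x

  0≤x*y : ∀ {x y} → 0# ≤ x → 0# ≤ y → 0# ≤ x * y
  0≤x*y {x} {y} 0≤x 0≤y xy<0 = by-trichotomy 0# x
    (λ 0<x → by-trichotomy 0# y
      (λ 0<y → <⇒≤ (*-pos 0<x 0<y) xy<0)
      (λ 0≈y → <-irrefl (trans (*-congˡ (sym 0≈y)) (zeroʳ x)) xy<0)
      0≤y)
    (λ 0≈x → <-irrefl (trans (*-congʳ (sym 0≈x)) (zeroˡ y)) xy<0)
    0≤x

  0≤x*x : ∀ x → 0# ≤ x * x
  0≤x*x x xx<0 = by-trichotomy 0# x
    (λ 0<x → <⇒≤ (*-pos 0<x 0<x) xx<0)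
    (λ 0≈x → <-irrefl (trans (*-congʳ (sym 0≈x)) (zeroˡ x)) xx<0)
    (λ x<0 → <⇒≤ (*-pos (x<0⇒0<-x x<0) (x<0⇒0<-x x<0))
      (<-respˡ (solve 1 (λ x → x :* x := (:- x) :* (:- x)) refl x) xx<0))

  x^2≈x*x : ∀ x → x ^ 2 ≈ x * x
  x^2≈x*x x = *-congˡ (*-identityʳ x)

  0≤x^2 : ∀ x → 0# ≤ x ^ 2
  0≤x^2 x = ≤-respʳ (sym (x^2≈x*x x)) (0≤x*x x)

  ^2-mono-≤ : ∀ {x y} → 0# ≤ x → x ≤ y → x ^ 2 ≤ y ^ 2
  ^2-mono-≤ {x} {y} 0≤x x≤y = 0≤y-x⇒x≤y (≤-respʳ
    -- The factorisation y² - x² = (y - x)((y - x) + 2x) has visibly nonnegative factors.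
    (solve 2 (λ x y → (y :- x) :* ((y :- x) :+ (x :+ x)) := y :^ 2 :- x :^ 2) refl x y)
    (0≤x*y (x≤y⇒0≤y-x x≤y) (0≤x+y (x≤y⇒0≤y-x x≤y) (0≤x+y 0≤x 0≤x))))

  0<x∧0≤x*y⇒0≤y : ∀ {x y} → 0# < x → 0# ≤ x * y → 0# ≤ y
  0<x∧0≤x*y⇒0≤y {x} {y} 0<x 0≤xy y<0 = 0≤xy (<-respˡ
    (solve 2 (λ x y → :- (x :* (:- y)) := x :* y) refl x y)
    (0<x⇒-x<0 (*-pos 0<x (x<0⇒0<-x y<0))))

  -- Dividing by `x` would need it apart from zero. Instead, if `y` were apart from zero, then `x`
  -- could not be, since the product of two such numbers is apart from zero; tightness turns both
  -- denials into equations.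
  x*y≈0∧x≉0⇒y≈0 : ∀ {x y} → x * y ≈ 0# → ¬ x ≈ 0# → y ≈ 0#
  x*y≈0∧x≉0⇒y≈0 {x} {y} xy≈0 x≉0 = proj₁ (tight y 0#) λ y#0 →
    x≉0 (proj₁ (tight x 0#) λ x#0 → proj₂ (tight (x * y) 0#) xy≈0 (x#0y#0→xy#0 x#0 y#0))

  x*x≈0⇒x≈0 : ∀ {x} → x * x ≈ 0# → x ≈ 0#
  x*x≈0⇒x≈0 {x} xx≈0 = proj₁ (tight x 0#) λ x#0 → proj₂ (tight (x * x) 0#) xx≈0 (x#0y#0→xy#0 x#0 x#0)

  quotient-cancel : ∀ x y (y#0 : y # 0#) → y * quotient x y y#0 ≈ x
  quotient-cancel x y y#0 = begin
    y * (x * y⁻¹)      ≈⟨ solve 3 (λ x y z → y :* (x :* z) := x :* (z :* y)) refl x y y⁻¹ ⟩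
    x * (y⁻¹ * y)      ≈⟨ *-congˡ (*-congˡ (x-0≈x y)) ⟨
    x * (y⁻¹ * (y - 0#)) ≈⟨ *-congˡ (proj₁ (proj₂ (#⇒invertible y#0))) ⟩
    x * 1#             ≈⟨ *-identityʳ x ⟩
    x                  ∎
    where y⁻¹ = proj₁ (#⇒invertible y#0)

  0<1 : 0# < 1#
  0<1 with #⇒<⊎> 1#0
  ... | inj₂ 0<1 = 0<1
  ... | inj₁ 1<0 = ⊥-elim (0≤x*x 1# (<-respˡ (sym (*-identityʳ 1#)) 1<0))

  0≤fromℕ : ∀ m → 0# ≤ fromℕ m
  0≤fromℕ zero    = ≤-refl
  0≤fromℕ (suc m) = 0≤x+y (<⇒≤ 0<1) (0≤fromℕ m)

  0<fromℕ[1+m] : ∀ m → 0# < fromℕ (suc m)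
  0<fromℕ[1+m] zero    = <-respʳ (sym (+-identityʳ 1#)) 0<1
  0<fromℕ[1+m] (suc m) = <-trans (0<fromℕ[1+m] m) (<-respˡ (+-identityˡ _) (+-monoˡ-< _ 0<1))

  0≤sum : ∀ {m} {f : Vector Carrier m} → (∀ i → 0# ≤ f i) → 0# ≤ sum f
  0≤sum {zero}  0≤f = ≤-refl
  0≤sum {suc m} 0≤f = 0≤x+y (0≤f Fin.zero) (0≤sum (0≤f ∘ Fin.suc))

  x+y≈0⇒x≈0 : ∀ {x y} → 0# ≤ x → 0# ≤ y → x + y ≈ 0# → x ≈ 0#
  x+y≈0⇒x≈0 {x} {y} 0≤x 0≤y x+y≈0 = 0≤x∧0≤-x⇒x≈0 0≤x (≤-respʳ (begin
    y             ≈⟨ solve 2 (λ x y → y := (x :+ y) :- x) refl x y ⟩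
    (x + y) - x   ≈⟨ +-congʳ x+y≈0 ⟩
    0# - x        ≈⟨ +-identityˡ (- x) ⟩
    - x           ∎) 0≤y)

  sum≈0⇒≈0 : ∀ {m} {f : Vector Carrier m} → (∀ i → 0# ≤ f i) → sum f ≈ 0# → ∀ i → f i ≈ 0#
  sum≈0⇒≈0 0≤f Σf≈0 Fin.zero    = x+y≈0⇒x≈0 (0≤f Fin.zero) (0≤sum (0≤f ∘ Fin.suc)) Σf≈0
  sum≈0⇒≈0 0≤f Σf≈0 (Fin.suc i) = sum≈0⇒≈0 (0≤f ∘ Fin.suc)
    (x+y≈0⇒x≈0 (0≤sum (0≤f ∘ Fin.suc)) (0≤f Fin.zero) (trans (+-comm _ _) Σf≈0)) i

  -- Cancels the number of terms without inverting it: a negative `x` makes every nonempty sum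
  -- negative. The argument of type `Fin m` excludes m = 0.
  0≤sum-replicate⇒0≤ : ∀ {m x} → Fin m → 0# ≤ sum {m} (λ _ → x) → 0# ≤ x
  0≤sum-replicate⇒0≤ {suc m} {x} _ 0≤Σ x<0 = 0≤Σ (negative m)
    where
    negative : ∀ m → sum {suc m} (λ _ → x) < 0#
    negative zero    = <-respˡ (sym (+-identityʳ x)) x<0
    negative (suc m) = <-trans (<-respʳ (+-identityˡ _) (+-monoˡ-< _ x<0)) (negative m)

  sum-cong : ∀ {m} {f g : Vector Carrier m} → (∀ i → f i ≈ g i) → sum f ≈ sum g
  sum-cong = sum-cong-≋

  sum≈0 : ∀ {m} {f : Vector Carrier m} → (∀ i → f i ≈ 0#) → sum f ≈ 0#
  sum≈0 {m} f≈0 = trans (sum-cong f≈0) (sum-replicate-zero m)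

  sum-isolate : ∀ {m} {f : Vector Carrier m} j → (∀ i → i ≢ j → f i ≈ 0#) → sum f ≈ f j
  sum-isolate {suc m} {f} j f≈0 = begin
    sum f                                ≈⟨ sum-remove {i = j} f ⟩
    f j + sum (λ i → f (Fin.punchIn j i)) ≈⟨ +-congˡ (sum≈0 λ i → f≈0 _ (Fin.punchInᵢ≢i j i)) ⟩
    f j + 0#                             ≈⟨ +-identityʳ (f j) ⟩
    f j                                  ∎

  sum-neg : ∀ {m} (f : Vector Carrier m) → sum (λ i → - f i) ≈ - sum f
  sum-neg {zero}  f = sym -0#≈0#
  sum-neg {suc m} f = trans (+-congˡ (sum-neg (f ∘ Fin.suc)))
    (solve 2 (λ x y → (:- x) :- y := :- (x :+ y)) refl (f Fin.zero) (sum (f ∘ Fin.suc)))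

  ∑-distrib-sub : ∀ {m} (f g : Vector Carrier m) → sum (λ i → f i - g i) ≈ sum f - sum g
  ∑-distrib-sub f g = trans (∑-distrib-+ f (λ i → - g i)) (+-congˡ (sum-neg g))

  -- Matrices acting on vectors

  module _ {N : ℕ} where

    infixr 8 _▹_

    _▹_ : Matrix N → Vector Carrier N → Vector Carrier N
    (M ▹ u) x = sum λ y → M x y * u y

    ▹-cong : ∀ (M : Matrix N) {u v} → (∀ x → u x ≈ v x) → ∀ x → (M ▹ u) x ≈ (M ▹ v) x
    ▹-cong M u≈v x = sum-cong λ y → *-congˡ (u≈v y)

    ▹-congˡ : ∀ {L M : Matrix N} → (∀ x y → L x y ≈ M x y) → ∀ u x → (L ▹ u) x ≈ (M ▹ u) x
    ▹-congˡ L≈M u x = sum-cong λ y → *-congʳ (L≈M x y)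

    ▹-distrib-+ : ∀ (M : Matrix N) u v x → (M ▹ (λ y → u y + v y)) x ≈ (M ▹ u) x + (M ▹ v) x
    ▹-distrib-+ M u v x = trans (sum-cong λ y → distribˡ (M x y) (u y) (v y))
      (∑-distrib-+ (λ y → M x y * u y) (λ y → M x y * v y))

    ▹-scale : ∀ (M : Matrix N) t u x → (M ▹ (λ y → t * u y)) x ≈ t * (M ▹ u) x
    ▹-scale M t u x = trans
      (sum-cong λ y → solve 3 (λ m t u → m :* (t :* u) := t :* (m :* u)) refl (M x y) t (u y))
      (sym (*-distribˡ-sum t (λ y → M x y * u y)))

    ▹-distrib-sub : ∀ (M : Matrix N) u v x → (M ▹ (λ y → u y - v y)) x ≈ (M ▹ u) x - (M ▹ v) x
    ▹-distrib-sub M u v x = trans (sum-cong λ y → x[y-z]≈xy-xz (M x y) (u y) (v y))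
      (∑-distrib-sub (λ y → M x y * u y) (λ y → M x y * v y))

    ▹-sum : ∀ {m} (M : Matrix N) (w : Fin m → Vector Carrier N) x →
            (M ▹ (λ y → sum λ j → w j y)) x ≈ sum λ j → (M ▹ w j) x
    ▹-sum M w x = trans (sum-cong λ y → *-distribˡ-sum (M x y) (λ j → w j y))
      (∑-comm λ y j → M x y * w j y)

    identity-▹ : ∀ u x → (identity ▹ u) x ≈ u x
    identity-▹ u x = begin
      (identity ▹ u) x                                ≈⟨ sum-isolate x off ⟩
      (if does (x Fin.≟ x) then 1# else 0#) * u x ≈⟨ *-congʳ (reflexive (≡.cong (λ b → if b then 1# else 0#) (dec-true (x Fin.≟ x) ≡.refl))) ⟩
      1# * u x                                        ≈⟨ *-identityˡ (u x) ⟩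
      u x                                             ∎
      where
      off : ∀ y → y ≢ x → identity x y * u y ≈ 0#
      off y y≢x with x Fin.≟ y
      ... | yes x≡y = contradiction (≡.sym x≡y) y≢x
      ... | no  _   = zeroˡ (u y)

    ⊗-▹ : ∀ L M u x → ((L ⊗ M) ▹ u) x ≈ (L ▹ (M ▹ u)) x
    ⊗-▹ L M u x = begin
      sum (λ y → sum (λ z → L x z * M z y) * u y)     ≈⟨ sum-cong (λ y → *-distribʳ-sum (u y) (λ z → L x z * M z y)) ⟩
      sum (λ y → sum (λ z → L x z * M z y * u y))     ≈⟨ ∑-comm (λ y z → L x z * M z y * u y) ⟩
      sum (λ z → sum (λ y → L x z * M z y * u y))     ≈⟨ sum-cong (λ z → sum-cong λ y → *-assoc (L x z) (M z y) (u y)) ⟩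
      sum (λ z → sum (λ y → L x z * (M z y * u y)))   ≈⟨ sum-cong (λ z → *-distribˡ-sum (L x z) (λ y → M z y * u y)) ⟨
      (L ▹ (M ▹ u)) x                                  ∎

    -- Zero vectors are allowed, unlike in `IsEigenvalue`, because a component of a decomposition
    -- may vanish.
    Eigen : Matrix N → Carrier → Vector Carrier N → Set ℓ₁
    Eigen M t w = ∀ x → (M ▹ w) x ≈ t * w x

    Eigen-scale : ∀ {M t w} s → Eigen M t w → Eigen M t (λ x → s * w x)
    Eigen-scale {M} {t} {w} s eigen x = begin
      (M ▹ (λ y → s * w y)) x ≈⟨ ▹-scale M s w x ⟩
      s * (M ▹ w) x           ≈⟨ *-congˡ (eigen x) ⟩
      s * (t * w x)           ≈⟨ solve 3 (λ s t w → s :* (t :* w) := t :* (s :* w)) refl s t (w x) ⟩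
      t * (s * w x)           ∎

  -- Polynomials in a matrix

  -- For m = suc i this is definitionally eval.
  evalAt : ∀ {m} → Vector Carrier m → Carrier → Carrier
  evalAt p t = sum λ k → p k * t ^ Fin.toℕ k

  evalAt-suc : ∀ {m} (p : Vector Carrier (suc m)) t →
               evalAt p t ≈ p Fin.zero + t * evalAt (p ∘ Fin.suc) t
  evalAt-suc p t = +-cong (*-identityʳ _) (trans
    (sum-cong λ k → solve 3 (λ a t s → a :* (t :* s) := t :* (a :* s)) refl (p (Fin.suc k)) t (t ^ Fin.toℕ k))
    (sym (*-distribˡ-sum t λ k → p (Fin.suc k) * t ^ Fin.toℕ k)))

  -- Horner's scheme applied directly to a vector. Recursion on the coefficients replaces matrix
  -- powers and turns synthetic division into an induction.
  act : ∀ {m N} → Vector Carrier m → Matrix N → Vector Carrier N → Vector Carrier N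
  act {zero}  p M u x = 0#
  act {suc m} p M u x = p Fin.zero * u x + (M ▹ act (p ∘ Fin.suc) M u) x

  act-cong : ∀ {m N} (p : Vector Carrier m) (M : Matrix N) {u v} →
             (∀ x → u x ≈ v x) → ∀ x → act p M u x ≈ act p M v x
  act-cong {zero}  p M u≈v x = refl
  act-cong {suc m} p M u≈v x = +-cong (*-congˡ (u≈v x)) (▹-cong M (act-cong (p ∘ Fin.suc) M u≈v) x)

  act-power : ∀ {m N} (p : Vector Carrier m) (M : Matrix N) u x →
              sum (λ k → p k * (power M (Fin.toℕ k) ▹ u) x) ≈ act p M u x
  act-power {zero}  p M u x = refl
  act-power {suc m} p M u x = +-cong (*-congˡ (identity-▹ u x)) (begin
    sum (λ k → p (Fin.suc k) * ((M ⊗ power M (Fin.toℕ k)) ▹ u) x)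
      ≈⟨ sum-cong {m} (λ k → *-congˡ (⊗-▹ M (power M (Fin.toℕ k)) u x)) ⟩
    sum (λ k → p (Fin.suc k) * (M ▹ (power M (Fin.toℕ k) ▹ u)) x)
      ≈⟨ sum-cong (λ k → ▹-scale M (p (Fin.suc k)) (power M (Fin.toℕ k) ▹ u) x) ⟨
    sum (λ k → (M ▹ (λ y → p (Fin.suc k) * (power M (Fin.toℕ k) ▹ u) y)) x)
      ≈⟨ ▹-sum M (λ k y → p (Fin.suc k) * (power M (Fin.toℕ k) ▹ u) y) x ⟨
    (M ▹ (λ y → sum λ k → p (Fin.suc k) * (power M (Fin.toℕ k) ▹ u) y)) x
      ≈⟨ ▹-cong M (act-power (p ∘ Fin.suc) M u) x ⟩
    (M ▹ act (p ∘ Fin.suc) M u) x ∎)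

  evalMatrix-▹ : ∀ {i N} (p : Poly i) (M : Matrix N) u x → (evalMatrix p M ▹ u) x ≈ act p M u x
  evalMatrix-▹ p M u x = begin
    sum (λ y → sum (λ k → p k * power M (Fin.toℕ k) x y) * u y)
      ≈⟨ sum-cong (λ y → *-distribʳ-sum (u y) (λ k → p k * power M (Fin.toℕ k) x y)) ⟩
    sum (λ y → sum (λ k → p k * power M (Fin.toℕ k) x y * u y))
      ≈⟨ ∑-comm (λ y k → p k * power M (Fin.toℕ k) x y * u y) ⟩
    sum (λ k → sum (λ y → p k * power M (Fin.toℕ k) x y * u y))
      ≈⟨ sum-cong (λ k → sum-cong λ y → *-assoc (p k) (power M (Fin.toℕ k) x y) (u y)) ⟩
    sum (λ k → sum (λ y → p k * (power M (Fin.toℕ k) x y * u y)))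
      ≈⟨ sum-cong (λ k → *-distribˡ-sum (p k) (λ y → power M (Fin.toℕ k) x y * u y)) ⟨
    sum (λ k → p k * (power M (Fin.toℕ k) ▹ u) x)
      ≈⟨ act-power p M u x ⟩
    act p M u x ∎

  act-eigen : ∀ {m N} (p : Vector Carrier m) {M : Matrix N} {t w} → Eigen M t w →
              ∀ x → act p M w x ≈ evalAt p t * w x
  act-eigen {zero}  p {w = w} eigen x = sym (zeroˡ (w x))
  act-eigen {suc m} p {M} {t} {w} eigen x = begin
    p₀ * w x + (M ▹ act p′ M w) x             ≈⟨ +-congˡ (▹-cong M (act-eigen p′ eigen) x) ⟩
    p₀ * w x + (M ▹ (λ y → evalAt p′ t * w y)) x ≈⟨ +-congˡ (Eigen-scale (evalAt p′ t) eigen x) ⟩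
    p₀ * w x + t * (evalAt p′ t * w x)        ≈⟨ solve 4 (λ a w t e → a :* w :+ t :* (e :* w) := (a :+ t :* e) :* w) refl p₀ (w x) t (evalAt p′ t) ⟩
    (p₀ + t * evalAt p′ t) * w x              ≈⟨ *-congʳ (evalAt-suc p t) ⟨
    evalAt p t * w x                          ∎
    where
    p₀ = p Fin.zero
    p′ = p ∘ Fin.suc

  -- The quotient on dividing p(t) − p(θ) by t − θ (synthetic division).
  divide : ∀ {m} → Vector Carrier (suc m) → Carrier → Vector Carrier m
  divide {suc m} p θ Fin.zero    = evalAt (p ∘ Fin.suc) θ
  divide {suc m} p θ (Fin.suc k) = divide (p ∘ Fin.suc) θ k

  -- Keeps the leading coefficient nonzero while `decompose` divides out roots.
  divide-last : ∀ {m} (p : Vector Carrier (suc (suc m))) θ →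
                divide p θ (Fin.fromℕ m) ≈ p (Fin.fromℕ (suc m))
  divide-last {zero}  p θ = trans (+-identityʳ _) (*-identityʳ _)
  divide-last {suc m} p θ = divide-last (p ∘ Fin.suc) θ

  -- The remainder theorem p(t) = p(θ) + q(t)(t - θ) with `M` in place of t. In the induction, p =
  -- p₀ + t p′ has the quotient q = p′(θ) + t q′, where q′ is the quotient of p′.
  act-divide : ∀ {m N} (p : Vector Carrier (suc m)) θ (M : Matrix N) u x →
               act p M u x ≈ evalAt p θ * u x + act (divide p θ) M (λ y → (M ▹ u) y - θ * u y) x
  act-divide {zero} p θ M u x = +-cong
    (*-congʳ (sym (trans (+-identityʳ _) (*-identityʳ _))))
    (sum≈0 λ y → zeroʳ (M x y))
  act-divide {suc m} p θ M u x = begin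
    p₀ * u x + (M ▹ act p′ M u) x
      ≈⟨ +-congˡ (▹-cong M (act-divide p′ θ M u) x) ⟩
    p₀ * u x + (M ▹ (λ y → e * u y + act (divide p′ θ) M u′ y)) x
      ≈⟨ +-congˡ (▹-distrib-+ M (λ y → e * u y) (act (divide p′ θ) M u′) x) ⟩
    p₀ * u x + ((M ▹ (λ y → e * u y)) x + (M ▹ act (divide p′ θ) M u′) x)
      ≈⟨ +-congˡ (+-congʳ (▹-scale M e u x)) ⟩
    p₀ * u x + (e * (M ▹ u) x + (M ▹ act (divide p′ θ) M u′) x)
      ≈⟨ solve 6 (λ a u e m r θ → a :* u :+ (e :* m :+ r) := (a :+ θ :* e) :* u :+ (e :* (m :- θ :* u) :+ r)) refl
           p₀ (u x) e ((M ▹ u) x) ((M ▹ act (divide p′ θ) M u′) x) θ ⟩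
    (p₀ + θ * e) * u x + (e * u′ x + (M ▹ act (divide p′ θ) M u′) x)
      ≈⟨ +-congʳ (*-congʳ (evalAt-suc p θ)) ⟨
    evalAt p θ * u x + (e * u′ x + (M ▹ act (divide p′ θ) M u′) x) ∎
    where
    p₀ = p Fin.zero
    p′ = p ∘ Fin.suc
    e  = evalAt p′ θ
    u′ = λ y → (M ▹ u) y - θ * u y

  Eigen-shift : ∀ {N} {M : Matrix N} {t w} s → Eigen M t w → ∀ x → (M ▹ w) x - s * w x ≈ (t - s) * w x
  Eigen-shift {t = t} {w} s eigen x = trans (+-congʳ (eigen x))
    (solve 3 (λ t s w → t :* w :- s :* w := (t :- s) :* w) refl t s (w x))

  -- The matrix form of the division, applied to a 1 × 1 matrix.
  evalAt-divide : ∀ {m} (p : Vector Carrier (suc m)) θ t →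
                  evalAt p t ≈ evalAt p θ + evalAt (divide p θ) t * (t - θ)
  evalAt-divide p θ t = begin
    evalAt p t                                          ≈⟨ *-identityʳ _ ⟨
    evalAt p t * 1#                                     ≈⟨ act-eigen p {M} {w = one} eigen Fin.zero ⟨
    act p M one Fin.zero                                ≈⟨ act-divide p θ M one Fin.zero ⟩
    evalAt p θ * 1# + act (divide p θ) M (λ y → (M ▹ one) y - θ * one y) Fin.zero
      ≈⟨ +-cong (*-identityʳ _) (trans (act-cong (divide p θ) M (Eigen-shift {M = M} {w = one} θ eigen) Fin.zero)
           (act-eigen (divide p θ) {M} (Eigen-scale {M = M} {w = one} (t - θ) eigen) Fin.zero)) ⟩
    evalAt p θ + evalAt (divide p θ) t * ((t - θ) * 1#) ≈⟨ +-congˡ (*-congˡ (*-identityʳ _)) ⟩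
    evalAt p θ + evalAt (divide p θ) t * (t - θ)        ∎
    where
    M : Matrix 1
    M _ _ = t
    one : Vector Carrier 1
    one _ = 1#
    eigen : Eigen M t one
    eigen _ = +-identityʳ _

  divide-root : ∀ {m} (p : Vector Carrier (suc m)) {θ t} → evalAt p θ ≈ 0# → evalAt p t ≈ 0# →
                t # θ → evalAt (divide p θ) t ≈ 0#
  divide-root p {θ} {t} pθ≈0 pt≈0 t#θ = x*y≈0∧x≉0⇒y≈0 (begin
    (t - θ) * evalAt (divide p θ) t              ≈⟨ *-comm _ _ ⟩
    evalAt (divide p θ) t * (t - θ)              ≈⟨ +-identityˡ _ ⟨
    0# + evalAt (divide p θ) t * (t - θ)         ≈⟨ +-congʳ pθ≈0 ⟨
    evalAt p θ + evalAt (divide p θ) t * (t - θ) ≈⟨ evalAt-divide p θ t ⟨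
    evalAt p t                                   ≈⟨ pt≈0 ⟩
    0#                                           ∎)
    (λ t-θ≈0 → proj₂ (tight t θ) (x∙y⁻¹≈ε⇒x≈y t θ t-θ≈0) t#θ)

  Decomposes : ∀ {N k} → Matrix N → (Fin k → Carrier) → Vector Carrier N → Set (c ⊔ ℓ₁)
  Decomposes {N} {k} M θ u = Σ (Fin k → Vector Carrier N) λ w →
    (∀ j → Eigen M (θ j) (w j)) ×ᵖ (∀ x → u x ≈ sum λ j → w j x)

  -- If p(M) u = 0 then q(M) kills (M − θ₀) u, where p = (t − θ₀) q; dividing the
  -- θⱼ-component of (M − θ₀) u by θⱼ − θ₀ gives that of u.
  decompose : ∀ {k N} (M : Matrix N) (p : Poly k) → HasDegree k p → (θ : Fin k → Carrier) →
              (∀ {i j} → i Fin.< j → θ j # θ i) → (∀ j → evalAt p (θ j) ≈ 0#) →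
              ∀ u → (∀ x → act p M u x ≈ 0#) → Decomposes M θ u
  -- A nonzero constant that kills `u` forces `u` to vanish, so it is the empty sum.
  decompose {zero} M p p≉0 θ θ# roots u pu≈0 = (λ ()) , (λ ()) , λ x →
    x*y≈0∧x≉0⇒y≈0 (trans (sym (trans (+-congˡ (sum≈0 λ y → zeroʳ (M x y))) (+-identityʳ _))) (pu≈0 x)) p≉0
  decompose {suc k} {N} M p p≉0 θ θ# roots u pu≈0 = w , eigen , λ x →
    solve 2 (λ u s → u := (u :- s) :+ s) refl (u x) (Σw x)
    where
    θ₀ = θ Fin.zero
    u′ : Vector Carrier N
    u′ x = (M ▹ u) x - θ₀ * u x

    θⱼ#θ₀ : ∀ j → θ (Fin.suc j) # θ₀
    θⱼ#θ₀ j = θ# (ℕ.s≤s ℕ.z≤n)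

    rest : Decomposes M (θ ∘ Fin.suc) u′
    rest = decompose M (divide p θ₀) (λ q≈0 → p≉0 (trans (sym (divide-last p θ₀)) q≈0)) (θ ∘ Fin.suc)
      (λ i<j → θ# (ℕ.s≤s i<j))
      (λ j → divide-root p (roots Fin.zero) (roots (Fin.suc j)) (θⱼ#θ₀ j))
      u′ λ x → begin
        act (divide p θ₀) M u′ x                      ≈⟨ +-identityˡ _ ⟨
        0# + act (divide p θ₀) M u′ x                 ≈⟨ +-congʳ (trans (*-congʳ (roots Fin.zero)) (zeroˡ (u x))) ⟨
        evalAt p θ₀ * u x + act (divide p θ₀) M u′ x  ≈⟨ act-divide p θ₀ M u x ⟨
        act p M u x                                   ≈⟨ pu≈0 x ⟩
        0#                                            ∎

    w′ : Fin k → Vector Carrier N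
    w′ j x = proj₁ (#⇒invertible (θⱼ#θ₀ j)) * proj₁ rest j x

    Σw : Vector Carrier N
    Σw x = sum λ j → w′ j x

    w : Fin (suc k) → Vector Carrier N
    -- The θ₀-component is whatever the others leave over. It is an eigenvector because, by
    -- `shifted`, M - θ₀ takes the same value on `u` and on `Σw`.
    w Fin.zero    x = u x - Σw x
    w (Fin.suc j) = w′ j

    eigen′ : ∀ j → Eigen M (θ (Fin.suc j)) (w′ j)
    eigen′ j = Eigen-scale (proj₁ (#⇒invertible (θⱼ#θ₀ j))) (proj₁ (proj₂ rest) j)

    unscale : ∀ j x → (θ (Fin.suc j) - θ₀) * w′ j x ≈ proj₁ rest j x
    unscale j x = begin
      d * (d⁻¹ * proj₁ rest j x) ≈⟨ *-assoc d d⁻¹ _ ⟨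
      d * d⁻¹ * proj₁ rest j x   ≈⟨ *-congʳ (proj₂ (proj₂ (#⇒invertible (θⱼ#θ₀ j)))) ⟩
      1# * proj₁ rest j x        ≈⟨ *-identityˡ _ ⟩
      proj₁ rest j x             ∎
      where
      d   = θ (Fin.suc j) - θ₀
      d⁻¹ = proj₁ (#⇒invertible (θⱼ#θ₀ j))

    shifted : ∀ x → u′ x ≈ (M ▹ Σw) x - θ₀ * Σw x
    shifted x = begin
      u′ x                                            ≈⟨ proj₂ (proj₂ rest) x ⟩
      sum (λ j → proj₁ rest j x)                      ≈⟨ sum-cong (λ j → trans (Eigen-shift θ₀ (eigen′ j) x) (unscale j x)) ⟨
      sum (λ j → (M ▹ w′ j) x - θ₀ * w′ j x)          ≈⟨ ∑-distrib-sub (λ j → (M ▹ w′ j) x) (λ j → θ₀ * w′ j x) ⟩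
      sum (λ j → (M ▹ w′ j) x) - sum (λ j → θ₀ * w′ j x)
        ≈⟨ +-cong (▹-sum M w′ x) (-‿cong (*-distribˡ-sum θ₀ (λ j → w′ j x))) ⟨
      (M ▹ Σw) x - θ₀ * Σw x                          ∎

    eigen : ∀ j → Eigen M (θ j) (w j)
    eigen Fin.zero x = begin
      (M ▹ (λ y → u y - Σw y)) x                      ≈⟨ ▹-distrib-sub M u Σw x ⟩
      (M ▹ u) x - (M ▹ Σw) x                          ≈⟨ solve 4 (λ m θ u n → m :- n := ((m :- θ :* u) :- n) :+ θ :* u) refl ((M ▹ u) x) θ₀ (u x) ((M ▹ Σw) x) ⟩
      (u′ x - (M ▹ Σw) x) + θ₀ * u x                  ≈⟨ +-congʳ (+-congʳ (shifted x)) ⟩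
      (((M ▹ Σw) x - θ₀ * Σw x) - (M ▹ Σw) x) + θ₀ * u x
        ≈⟨ solve 4 (λ n θ s u → ((n :- θ :* s) :- n) :+ θ :* u := θ :* (u :- s)) refl ((M ▹ Σw) x) θ₀ (Σw x) (u x) ⟩
      θ₀ * (u x - Σw x)                               ∎
    eigen (Fin.suc j) = eigen′ j

  -- Quadratic forms and eigenvectors

  module _ {N : ℕ} where

    ⟨_,_⟩ : Vector Carrier N → Vector Carrier N → Carrier
    ⟨ u , v ⟩ = sum λ x → u x * v x

    ⟨⟩-scaleʳ : ∀ t u v → ⟨ u , (λ x → t * v x) ⟩ ≈ t * ⟨ u , v ⟩
    ⟨⟩-scaleʳ t u v = trans
      (sum-cong λ x → solve 3 (λ t u v → u :* (t :* v) := t :* (u :* v)) refl t (u x) (v x))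
      (sym (*-distribˡ-sum t λ x → u x * v x))

    ⟨⟩-sym : ∀ u v → ⟨ u , v ⟩ ≈ ⟨ v , u ⟩
    ⟨⟩-sym u v = sum-cong λ x → *-comm (u x) (v x)

    ⟨⟩-sumʳ : ∀ {m} u (w : Fin m → Vector Carrier N) →
              ⟨ u , (λ x → sum λ j → w j x) ⟩ ≈ sum λ j → ⟨ u , w j ⟩
    ⟨⟩-sumʳ u w = trans (sum-cong λ x → *-distribˡ-sum (u x) (λ j → w j x)) (∑-comm λ x j → u x * w j x)

    0≤⟨u,u⟩ : ∀ u → 0# ≤ ⟨ u , u ⟩
    0≤⟨u,u⟩ u = 0≤sum λ x → 0≤x*x (u x)

    ⟨u,u⟩≈0⇒u≈0 : ∀ u → ⟨ u , u ⟩ ≈ 0# → ∀ x → u x ≈ 0#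
    ⟨u,u⟩≈0⇒u≈0 u uu≈0 x = x*x≈0⇒x≈0 (sum≈0⇒≈0 (λ y → 0≤x*x (u y)) uu≈0 x)

    Symmetric : Matrix N → Set ℓ₁
    Symmetric M = ∀ x y → M x y ≈ M y x

    ▹-selfAdjoint : ∀ {M} → Symmetric M → ∀ u v → ⟨ u , M ▹ v ⟩ ≈ ⟨ M ▹ u , v ⟩
    ▹-selfAdjoint {M} M-sym u v = begin
      sum (λ x → u x * sum (λ y → M x y * v y))   ≈⟨ sum-cong (λ x → *-distribˡ-sum (u x) (λ y → M x y * v y)) ⟩
      sum (λ x → sum (λ y → u x * (M x y * v y))) ≈⟨ ∑-comm (λ x y → u x * (M x y * v y)) ⟩
      sum (λ y → sum (λ x → u x * (M x y * v y))) ≈⟨ sum-cong (λ y → sum-cong λ x → swap x y) ⟩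
      sum (λ y → sum (λ x → M y x * u x * v y))   ≈⟨ sum-cong (λ y → *-distribʳ-sum (v y) (λ x → M y x * u x)) ⟨
      ⟨ M ▹ u , v ⟩                                ∎
      where
      swap : ∀ x y → u x * (M x y * v y) ≈ M y x * u x * v y
      swap x y = trans (*-congˡ (*-congʳ (M-sym x y)))
        (solve 3 (λ u m v → u :* (m :* v) := m :* u :* v) refl (u x) (M y x) (v y))

    -- By self-adjointness, ⟨u, M v⟩ equals both s ⟨u, v⟩ and t ⟨u, v⟩.
    Eigen-orthogonal : ∀ {M s t u v} → Symmetric M → Eigen M s u → Eigen M t v → s # t → ⟨ u , v ⟩ ≈ 0#
    Eigen-orthogonal {M} {s} {t} {u} {v} M-sym eigen-u eigen-v s#t = x*y≈0∧x≉0⇒y≈0 (begin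
      (s - t) * ⟨ u , v ⟩                       ≈⟨ solve 3 (λ s t p → (s :- t) :* p := s :* p :- t :* p) refl s t ⟨ u , v ⟩ ⟩
      s * ⟨ u , v ⟩ - t * ⟨ u , v ⟩             ≈⟨ +-cong (*-congˡ (⟨⟩-sym u v)) (-‿cong (sym (⟨⟩-scaleʳ t u v))) ⟩
      s * ⟨ v , u ⟩ - ⟨ u , (λ x → t * v x) ⟩   ≈⟨ +-congʳ (⟨⟩-scaleʳ s v u) ⟨
      ⟨ v , (λ x → s * u x) ⟩ - ⟨ u , (λ x → t * v x) ⟩
        ≈⟨ +-cong (sum-cong λ x → *-congˡ (eigen-u x)) (-‿cong (sum-cong λ x → *-congˡ (eigen-v x))) ⟨
      ⟨ v , M ▹ u ⟩ - ⟨ u , M ▹ v ⟩             ≈⟨ +-congʳ (trans (⟨⟩-sym v (M ▹ u)) (sym (▹-selfAdjoint M-sym u v))) ⟩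
      ⟨ u , M ▹ v ⟩ - ⟨ u , M ▹ v ⟩             ≈⟨ -‿inverseʳ _ ⟩
      0#                                        ∎)
      (λ s-t≈0 → proj₂ (tight s t) (x∙y⁻¹≈ε⇒x≈y s t s-t≈0) s#t)

    -- Parseval's identity for unnormalised, possibly vanishing components: orthogonality leaves
    -- only the diagonal terms of the double sum.
    ⟨⟩-orthogonal : ∀ {m} (w : Fin m → Vector Carrier N) → (∀ i j → i ≢ j → ⟨ w i , w j ⟩ ≈ 0#) →
                    ∀ (κ : Fin m → Carrier) u v → (∀ x → u x ≈ sum λ j → w j x) → (∀ x → v x ≈ sum λ j → κ j * w j x) →
                    ⟨ u , v ⟩ ≈ sum λ j → κ j * ⟨ w j , w j ⟩
    ⟨⟩-orthogonal w w⊥ κ u v u≈ v≈ = begin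
      ⟨ u , v ⟩                                   ≈⟨ sum-cong (λ x → *-congˡ (v≈ x)) ⟩
      ⟨ u , (λ x → sum λ j → κ j * w j x) ⟩       ≈⟨ ⟨⟩-sumʳ u (λ j x → κ j * w j x) ⟩
      sum (λ j → ⟨ u , (λ x → κ j * w j x) ⟩)     ≈⟨ sum-cong (λ j → trans (⟨⟩-scaleʳ (κ j) u (w j)) (*-congˡ (component j))) ⟩
      sum (λ j → κ j * ⟨ w j , w j ⟩)             ∎
      where
      component : ∀ j → ⟨ u , w j ⟩ ≈ ⟨ w j , w j ⟩
      component j = begin
        ⟨ u , w j ⟩                          ≈⟨ ⟨⟩-sym u (w j) ⟩
        ⟨ w j , u ⟩                          ≈⟨ sum-cong (λ x → *-congˡ (u≈ x)) ⟩
        ⟨ w j , (λ x → sum λ i → w i x) ⟩    ≈⟨ ⟨⟩-sumʳ (w j) w ⟩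
        sum (λ i → ⟨ w j , w i ⟩)            ≈⟨ sum-isolate j (λ i i≢j → w⊥ j i (i≢j ∘ ≡.sym)) ⟩
        ⟨ w j , w j ⟩                        ∎

    -- The Dirichlet form of a weighted graph, taken over ordered pairs, so that every edge counts
    -- twice.
    energy : Matrix N → Vector Carrier N → Carrier
    energy M u = sum λ x → sum λ y → M x y * (u x - u y) ^ 2

    0≤energy : ∀ {M} → (∀ x y → 0# ≤ M x y) → ∀ u → 0# ≤ energy M u
    0≤energy 0≤M u = 0≤sum λ x → 0≤sum λ y → 0≤x*y (0≤M x y) (0≤x^2 (u x - u y))

    𝟏 : Vector Carrier N
    𝟏 _ = 1#

    -- From m (a - b)² = a m (a - b) + b m (b - a): by symmetry of `M`, exchanging `x` and `y` shows
    -- that both halves have the same double sum, which is the quadratic form of the Laplacian.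
    energy-laplacian : ∀ {M r} → Symmetric M → Eigen M r 𝟏 → ∀ u →
                       energy M u ≈ ⟨ u , (λ x → r * u x - (M ▹ u) x) ⟩ + ⟨ u , (λ x → r * u x - (M ▹ u) x) ⟩
    energy-laplacian {M} {r} M-sym rows u = begin
      energy M u
        ≈⟨ sum-cong (λ x → trans (sum-cong λ y → split x y) (∑-distrib-+ (g x) (λ y → g y x))) ⟩
      sum (λ x → sum (λ y → g x y) + sum (λ y → g y x))
        ≈⟨ ∑-distrib-+ (λ x → sum λ y → g x y) (λ x → sum λ y → g y x) ⟩
      sum (λ x → sum (λ y → g x y)) + sum (λ x → sum (λ y → g y x))
        ≈⟨ +-congˡ (∑-comm (λ x y → g y x)) ⟩
      sum (λ x → sum (λ y → g x y)) + sum (λ x → sum (λ y → g x y))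
        ≈⟨ +-cong (sum-cong inner) (sum-cong inner) ⟩
      ⟨ u , (λ x → r * u x - (M ▹ u) x) ⟩ + ⟨ u , (λ x → r * u x - (M ▹ u) x) ⟩ ∎
      where
      g : Matrix N
      -- The factor `1#` makes the sum over `y` contain the row sum literally as `(M ▹ 𝟏) x`, to
      -- which `rows` applies.
      g x y = u x * (M x y * 1# * u x - M x y * u y)

      split : ∀ x y → M x y * (u x - u y) ^ 2 ≈ g x y + g y x
      split x y = trans
        (solve 3 (λ m a b → m :* (a :- b) :^ 2 := a :* (m :* a :- m :* b) :+ b :* (m :* b :- m :* a)) refl (M x y) (u x) (u y))
        (+-cong (*-congˡ (+-congʳ (*-congʳ (sym (*-identityʳ _)))))
          (*-congˡ (+-cong (*-congʳ (trans (M-sym x y) (sym (*-identityʳ _)))) (-‿cong (*-congʳ (M-sym x y))))))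

      inner : ∀ x → sum (λ y → g x y) ≈ u x * (r * u x - (M ▹ u) x)
      inner x = begin
        sum (λ y → g x y)
          ≈⟨ *-distribˡ-sum (u x) (λ y → M x y * 1# * u x - M x y * u y) ⟨
        u x * sum (λ y → M x y * 1# * u x - M x y * u y)
          ≈⟨ *-congˡ (∑-distrib-sub (λ y → M x y * 1# * u x) (λ y → M x y * u y)) ⟩
        u x * (sum (λ y → M x y * 1# * u x) - (M ▹ u) x)
          ≈⟨ *-congˡ (+-congʳ (*-distribʳ-sum (u x) (λ y → M x y * 1#))) ⟨
        u x * ((M ▹ 𝟏) x * u x - (M ▹ u) x)
          ≈⟨ *-congˡ (+-congʳ (*-congʳ (trans (rows x) (*-identityʳ r)))) ⟩
        u x * (r * u x - (M ▹ u) x) ∎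

    -- The energy of `w` is 2 (r - t) ‖w‖², and nonnegative weights make it nonnegative; the
    -- coordinate apart from zero prevents ‖w‖² = 0.
    eigenvalue≤rowSum : ∀ {M r t w x} → Symmetric M → (∀ x y → 0# ≤ M x y) → Eigen M r 𝟏 →
                        Eigen M t w → w x # 0# → 0# ≤ r - t
    eigenvalue≤rowSum {M} {r} {t} {w} {x} M-sym 0≤M rows eigen wx#0 r-t<0 = by-trichotomy 0# ⟨ w , w ⟩
      (λ 0<ww → 0<x∧0≤x*y⇒0≤y 0<ww (0<x∧0≤x*y⇒0≤y 0<1+1 (≤-respʳ twice (0≤energy 0≤M w))) r-t<0)
      (λ 0≈ww → proj₂ (tight (w x) 0#) (⟨u,u⟩≈0⇒u≈0 w (sym 0≈ww) x) wx#0)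
      (0≤⟨u,u⟩ w)
      where
      0<1+1 : 0# < 1# + 1#
      0<1+1 = <-trans 0<1 (<-respˡ (+-identityˡ 1#) (+-monoˡ-< 1# 0<1))

      form : ⟨ w , (λ x → r * w x - (M ▹ w) x) ⟩ ≈ ⟨ w , w ⟩ * (r - t)
      form = begin
        ⟨ w , (λ x → r * w x - (M ▹ w) x) ⟩  ≈⟨ sum-cong (λ x → *-congˡ (trans (+-congˡ (-‿cong (eigen x))) (solve 3 (λ r t a → r :* a :- t :* a := (r :- t) :* a) refl r t (w x)))) ⟩
        ⟨ w , (λ x → (r - t) * w x) ⟩        ≈⟨ ⟨⟩-scaleʳ (r - t) w w ⟩
        (r - t) * ⟨ w , w ⟩                  ≈⟨ *-comm _ _ ⟩
        ⟨ w , w ⟩ * (r - t)                  ∎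

      twice : energy M w ≈ (1# + 1#) * (⟨ w , w ⟩ * (r - t))
      twice = begin
        energy M w  ≈⟨ energy-laplacian M-sym rows w ⟩
        ⟨ w , (λ x → r * w x - (M ▹ w) x) ⟩ + ⟨ w , (λ x → r * w x - (M ▹ w) x) ⟩ ≈⟨ +-cong form form ⟩
        ⟨ w , w ⟩ * (r - t) + ⟨ w , w ⟩ * (r - t) ≈⟨ +-cong (*-identityˡ _) (*-identityˡ _) ⟨
        1# * (⟨ w , w ⟩ * (r - t)) + 1# * (⟨ w , w ⟩ * (r - t)) ≈⟨ distribʳ _ _ _ ⟨
        (1# + 1#) * (⟨ w , w ⟩ * (r - t)) ∎

    -- Expanding u in the eigenvectors wⱼ, the energy of u for W is 2 Σⱼ (r − λⱼ) ‖wⱼ‖².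
    0≤energy-spectral : ∀ {k} {M W : Matrix N} {θ : Fin k → Carrier} {r} {λ′ : Fin k → Carrier} {u} →
      Symmetric M → (∀ {i j} → i Fin.< j → θ j # θ i) → Decomposes M θ u →
      Symmetric W → Eigen W r 𝟏 → (∀ j w → Eigen M (θ j) w → Eigen W (λ′ j) w) →
      (∀ j → 0# ≤ r - λ′ j) → 0# ≤ energy W u
    0≤energy-spectral {M = M} {W} {θ} {r} {λ′} {u} M-sym θ# (w , eigen , u≈) W-sym rows shared 0≤r-λ =
      ≤-respʳ (sym (energy-laplacian W-sym rows u)) (0≤x+y 0≤form 0≤form)
      where
      w⊥ : ∀ i j → i ≢ j → ⟨ w i , w j ⟩ ≈ 0#
      w⊥ i j i≢j with ℕ.<-cmp (Fin.toℕ i) (Fin.toℕ j)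
      ... | tri< i<j _ _ = Eigen-orthogonal M-sym (eigen i) (eigen j) (#-sym (θ# i<j))
      ... | tri≈ _ i≡j _ = contradiction (Fin.toℕ-injective i≡j) i≢j
      ... | tri> _ _ j<i = Eigen-orthogonal M-sym (eigen i) (eigen j) (θ# j<i)

      expand : ∀ x → r * u x - (W ▹ u) x ≈ sum λ j → (r - λ′ j) * w j x
      expand x = begin
        r * u x - (W ▹ u) x
          ≈⟨ +-cong (trans (*-congˡ (u≈ x)) (*-distribˡ-sum r (λ j → w j x))) (-‿cong (trans (▹-cong W u≈ x) (▹-sum W w x))) ⟩
        sum (λ j → r * w j x) - sum (λ j → (W ▹ w j) x)
          ≈⟨ ∑-distrib-sub (λ j → r * w j x) (λ j → (W ▹ w j) x) ⟨
        sum (λ j → r * w j x - (W ▹ w j) x)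
          ≈⟨ sum-cong (λ j → trans (+-congˡ (-‿cong (shared j (w j) (eigen j) x)))
               (solve 3 (λ r t a → r :* a :- t :* a := (r :- t) :* a) refl r (λ′ j) (w j x))) ⟩
        sum (λ j → (r - λ′ j) * w j x) ∎

      0≤form : 0# ≤ ⟨ u , (λ x → r * u x - (W ▹ u) x) ⟩
      0≤form = ≤-respʳ (sym (⟨⟩-orthogonal w w⊥ (λ j → r - λ′ j) u (λ x → r * u x - (W ▹ u) x) u≈ expand))
        (0≤sum λ j → 0≤x*y (0≤r-λ j) (0≤⟨u,u⟩ (w j)))

  -- Polynomial arithmetic that preserves the leading coefficient

  infixl 6 _⊞_
  -- The second polynomial has one coefficient fewer, so the sum inherits the leading coefficient of
  -- the first. Both sums formed later have this shape: `v (suc i)` plus the lower `v j`, and t p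
  -- minus s p.
  _⊞_ : ∀ {m} → Vector Carrier (suc m) → Vector Carrier m → Vector Carrier (suc m)
  _⊞_ {zero}  p q k           = p k
  _⊞_ {suc m} p q Fin.zero    = p Fin.zero + q Fin.zero
  _⊞_ {suc m} p q (Fin.suc k) = ((p ∘ Fin.suc) ⊞ (q ∘ Fin.suc)) k

  ⊞-last : ∀ {m} (p : Vector Carrier (suc m)) q → (p ⊞ q) (Fin.fromℕ m) ≡ p (Fin.fromℕ m)
  ⊞-last {zero}  p q = ≡.refl
  ⊞-last {suc m} p q = ⊞-last (p ∘ Fin.suc) (q ∘ Fin.suc)

  act-⊞ : ∀ {m N} (p : Vector Carrier (suc m)) q (M : Matrix N) u x →
          act (p ⊞ q) M u x ≈ act p M u x + act q M u x
  act-⊞ {zero}  p q M u x = sym (+-identityʳ _)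
  act-⊞ {suc m} p q M u x = begin
    (p₀ + q₀) * u x + (M ▹ act (p′ ⊞ q′) M u) x
      ≈⟨ +-congˡ (trans (▹-cong M (act-⊞ p′ q′ M u) x) (▹-distrib-+ M (act p′ M u) (act q′ M u) x)) ⟩
    (p₀ + q₀) * u x + ((M ▹ act p′ M u) x + (M ▹ act q′ M u) x)
      ≈⟨ solve 5 (λ p q u a b → (p :+ q) :* u :+ (a :+ b) := (p :* u :+ a) :+ (q :* u :+ b)) refl
           p₀ q₀ (u x) ((M ▹ act p′ M u) x) ((M ▹ act q′ M u) x) ⟩
    act p M u x + act q M u x ∎
    where
    p₀ = p Fin.zero
    q₀ = q Fin.zero
    p′ = p ∘ Fin.suc
    q′ = q ∘ Fin.suc

  act-scale : ∀ {m N} s (p : Vector Carrier m) (M : Matrix N) u x →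
              act (λ k → s * p k) M u x ≈ s * act p M u x
  act-scale {zero}  s p M u x = sym (zeroʳ s)
  act-scale {suc m} s p M u x = trans
    (+-cong (*-assoc s (p Fin.zero) (u x))
      (trans (▹-cong M (act-scale s (p ∘ Fin.suc) M u) x) (▹-scale M s (act (p ∘ Fin.suc) M u) x)))
    (sym (distribˡ s _ _))

  times-t-minus : ∀ {m} → Carrier → Vector Carrier (suc m) → Vector Carrier (suc (suc m))
  times-t-minus s p = (0# VF.∷ p) ⊞ (λ k → - s * p k)

  times-t-minus-last : ∀ {m} s (p : Vector Carrier (suc m)) →
                       times-t-minus s p (Fin.fromℕ (suc m)) ≡ p (Fin.fromℕ m)
  times-t-minus-last s p = ⊞-last (0# VF.∷ p) (λ k → - s * p k)

  act-times-t-minus : ∀ {m N} s (p : Vector Carrier (suc m)) (M : Matrix N) u x →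
                      act (times-t-minus s p) M u x ≈ (M ▹ act p M u) x - s * act p M u x
  act-times-t-minus s p M u x = trans (act-⊞ (0# VF.∷ p) (λ k → - s * p k) M u x)
    (+-cong (trans (+-congʳ (zeroˡ (u x))) (+-identityˡ _))
      (trans (act-scale (- s) p M u x) (solve 2 (λ s a → (:- s) :* a := :- (s :* a)) refl s (act p M u x))))

  -- Indicators and counting

  indicator : Bool → Carrier
  indicator b = if b then 1# else 0#

  0≤indicator : ∀ b → 0# ≤ indicator b
  0≤indicator true  = <⇒≤ 0<1
  0≤indicator false = ≤-refl

  0≤indicator* : ∀ {p} {P : Set p} (P? : Dec P) {x} → (P → 0# ≤ x) → 0# ≤ indicator (does P?) * x
  0≤indicator* (yes p) 0≤x = ≤-respʳ (sym (*-identityˡ _)) (0≤x p)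
  0≤indicator* (no _)  0≤x = ≤-respʳ (sym (zeroˡ _)) ≤-refl

  -- Stated for a tabulated vector so that the induction can shift `f`; `allFin` is the case where
  -- `f` is `id`.
  sum-indicator : ∀ {a p} {A : Set a} {P : A → Set p} (P? : ∀ x → Dec (P x)) {m} (f : Fin m → A) →
                  sum (λ i → indicator (does (P? (f i)))) ≈ fromℕ (count P? (Vec.tabulate f))
  sum-indicator P? {zero}  f = refl
  sum-indicator P? {suc m} f with does (P? (f Fin.zero))
  ... | true  = +-congˡ (sum-indicator P? (f ∘ Fin.suc))
  ... | false = trans (+-identityˡ _) (sum-indicator P? (f ∘ Fin.suc))

-- Distance regular graphs

module DistanceRegularSpectrum {c ℓ₁ ℓ₂} (ℝ : Reals c ℓ₁ ℓ₂) {N : ℕ} (G : Graph N) (conn : Connected G)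
  (regular : DistanceRegular G conn) (1≤n : 1 ℕ.≤ diam G conn) where
  open OverReals ℝ
  open RealAlgebra ℝ
  open ≈-Reasoning setoid

  n : ℕ
  n = diam G conn

  d : Fin N → Fin N → ℕ
  d = dist G conn

  A : ℕ → Matrix N
  A = distanceMatrix G conn

  A-sym : ∀ i → Symmetric (A i)
  A-sym i x y = reflexive (≡.cong (λ k → indicator (does (k ℕ.≟ i))) (dist-sym G conn x y))

  0≤A : ∀ i x y → 0# ≤ A i x y
  0≤A i x y = 0≤indicator (does (d x y ℕ.≟ i))

  -- Every vertex has distance 0 from itself, so b₀ counts all its neighbours.
  degree : ℕ
  degree = DistanceRegular.b regular 0

  A₁-rows : Eigen (A 1) (fromℕ degree) 𝟏
  A₁-rows x = begin
    sum (λ z → A 1 x z * 1#)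
      ≈⟨ sum-cong (λ z → trans (*-identityʳ _) (reflexive (≡.cong indicator (neighbours z)))) ⟩
    sum (λ z → indicator (does (dist≟ z)))
      ≈⟨ sum-indicator dist≟ id ⟩
    fromℕ (count dist≟ (allFin N))
      ≡⟨ ≡.cong fromℕ (DistanceRegular.b-count regular x x) ⟨
    fromℕ (DistanceRegular.b regular (d x x))
      ≡⟨ ≡.cong (fromℕ ∘ DistanceRegular.b regular) (dist-refl G conn x) ⟩
    fromℕ degree
      ≈⟨ *-identityʳ _ ⟨
    fromℕ degree * 1# ∎
    where
    dist≟ : ∀ z → Dec (d x z ≡ 1 ×ᵖ d z x ≡ suc (d x x))
    dist≟ z = (d x z ℕ.≟ 1) ×-dec (d z x ℕ.≟ suc (d x x))

    neighbours : ∀ z → does (d x z ℕ.≟ 1) ≡ does (dist≟ z)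
    neighbours z = does-⇔ (mk⇔
      (λ xz≡1 → xz≡1 , ≡.trans (dist-sym G conn z x) (≡.trans xz≡1 (≡.cong suc (≡.sym (dist-refl G conn x)))))
      proj₁) (d x z ℕ.≟ 1) (dist≟ z)

  -- A zero degree would give a row of nonnegative entries with sum zero, hence a zero row, even at
  -- a vertex `x` that has a neighbour.
  0<degree : 0# < fromℕ degree
  0<degree with degree in deg≡
  ... | suc m = 0<fromℕ[1+m] m
  ... | zero with ∃-adjacent G conn 1≤n
  ...   | x , z , xz≡1 = ⊥-elim (proj₂ (tight 1# 0#) (begin
    1#           ≡⟨ ≡.cong indicator (dec-true (d x z ℕ.≟ 1) xz≡1) ⟨
    A 1 x z      ≈⟨ *-identityʳ _ ⟨
    A 1 x z * 1# ≈⟨ sum≈0⇒≈0 (λ y → 0≤x*y (0≤A 1 x y) (<⇒≤ 0<1)) row≈0 z ⟩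
    0#           ∎) 1#0)
    where
    row≈0 : sum (λ y → A 1 x y * 1#) ≈ 0#
    row≈0 = begin
      sum (λ y → A 1 x y * 1#) ≈⟨ A₁-rows x ⟩
      fromℕ degree * 1#        ≡⟨ ≡.cong (λ k → fromℕ k * 1#) deg≡ ⟩
      0# * 1#                  ≈⟨ zeroˡ 1# ⟩
      0#                       ∎

  -- The annihilating polynomial of the adjacency matrix

  module _ (v : ∀ i → Poly i) (isDP : IsDistancePolynomials G conn v) where

    A-▹ : ∀ {i} → i ℕ.≤ n → ∀ u x → (A i ▹ u) x ≈ act (v i) (A 1) u x
    A-▹ {i} i≤n u x = trans (▹-congˡ (proj₂ (isDP i i≤n)) u x) (evalMatrix-▹ (v i) (A 1) u x)

    A-eigen : ∀ {i} → i ℕ.≤ n → ∀ {t w} → Eigen (A 1) t w → Eigen (A i) (eval (v i) t) w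
    A-eigen {i} i≤n {w = w} eigen x = trans (A-▹ i≤n w x) (act-eigen (v i) eigen x)

    -- At index `n` this is the Hoffman polynomial of the graph.
    partial : ∀ i → Poly i
    partial zero    = v 0
    partial (suc i) = v (suc i) ⊞ partial i

    partial-degree : ∀ i → i ℕ.≤ n → HasDegree i (partial i)
    partial-degree zero    i≤n = proj₁ (isDP 0 i≤n)
    partial-degree (suc i) i≤n = proj₁ (isDP (suc i) i≤n) ∘ trans (reflexive (≡.sym (⊞-last (v (suc i)) (partial i))))

    -- The closed form of A₀ + ... + A_i, since each distance is met by one summand only. At i = n
    -- all entries are 1, as no distance exceeds the diameter.
    Ball : ℕ → Matrix N
    Ball i x y = indicator (does (d x y ℕ.≤? i))

    Ball-suc : ∀ i x y → A (suc i) x y + Ball i x y ≈ Ball (suc i) x y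
    Ball-suc i x y = case d x y ℕ.≟ suc i of λ where
      (yes ≡1+i) → begin
        A (suc i) x y + Ball i x y ≡⟨ ≡.cong₂ (λ b b′ → indicator b + indicator b′)
          (dec-true (d x y ℕ.≟ suc i) ≡1+i)
          (dec-false (d x y ℕ.≤? i) (ℕ.<⇒≱ (ℕ.≤-reflexive (≡.sym ≡1+i)))) ⟩
        1# + 0#                    ≈⟨ +-identityʳ 1# ⟩
        1#                         ≡⟨ ≡.cong indicator (dec-true (d x y ℕ.≤? suc i) (ℕ.≤-reflexive ≡1+i)) ⟨
        Ball (suc i) x y           ∎
      (no ≢1+i) → begin
        A (suc i) x y + Ball i x y ≡⟨ ≡.cong₂ (λ b b′ → indicator b + indicator b′)
          (dec-false (d x y ℕ.≟ suc i) ≢1+i)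
          (does-⇔ (mk⇔ ℕ.m≤n⇒m≤1+n (λ ≤1+i → ℕ.≤-pred (ℕ.≤∧≢⇒< ≤1+i ≢1+i))) (d x y ℕ.≤? i) (d x y ℕ.≤? suc i)) ⟩
        0# + Ball (suc i) x y      ≈⟨ +-identityˡ _ ⟩
        Ball (suc i) x y           ∎

    act-partial : ∀ i → i ℕ.≤ n → ∀ u x → act (partial i) (A 1) u x ≈ (Ball i ▹ u) x
    act-partial zero i≤n u x = trans (sym (A-▹ i≤n u x)) (▹-congˡ (λ x y → reflexive (≡.cong indicator
      (does-⇔ (mk⇔ ℕ.≤-reflexive ℕ.n≤0⇒n≡0) (d x y ℕ.≟ 0) (d x y ℕ.≤? 0)))) u x)
    act-partial (suc i) i<n u x = begin
      act (v (suc i) ⊞ partial i) (A 1) u x                       ≈⟨ act-⊞ (v (suc i)) (partial i) (A 1) u x ⟩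
      act (v (suc i)) (A 1) u x + act (partial i) (A 1) u x       ≈⟨ +-cong (sym (A-▹ i<n u x)) (act-partial i (ℕ.<⇒≤ i<n) u x) ⟩
      (A (suc i) ▹ u) x + (Ball i ▹ u) x                          ≈⟨ ∑-distrib-+ (λ y → A (suc i) x y * u y) (λ y → Ball i x y * u y) ⟨
      sum (λ y → A (suc i) x y * u y + Ball i x y * u y)
        ≈⟨ sum-cong (λ y → trans (sym (distribʳ (u y) (A (suc i) x y) (Ball i x y))) (*-congʳ (Ball-suc i x y))) ⟩
      (Ball (suc i) ▹ u) x                                        ∎

    -- The factor `1#` presents the constant vector as a multiple of `𝟏`, as `Eigen-scale` expects.
    act-partial-diam : ∀ u x → act (partial n) (A 1) u x ≈ sum u * 1#
    act-partial-diam u x = begin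
      act (partial n) (A 1) u x ≈⟨ act-partial n ℕ.≤-refl u x ⟩
      (Ball n ▹ u) x            ≈⟨ sum-cong (λ y → trans
        (*-congʳ (reflexive (≡.cong indicator (dec-true (d x y ℕ.≤? n) (dist≤diam G conn x y))))) (*-identityˡ (u y))) ⟩
      sum u                     ≈⟨ *-identityʳ _ ⟨
      sum u * 1#                ∎

    annihilator : Poly (suc n)
    annihilator = times-t-minus (fromℕ degree) (partial n)

    annihilator-degree : HasDegree (suc n) annihilator
    annihilator-degree = partial-degree n ℕ.≤-refl ∘
      trans (reflexive (≡.sym (times-t-minus-last (fromℕ degree) (partial n))))

    act-annihilator : ∀ u x → act annihilator (A 1) u x ≈ 0#
    act-annihilator u x = begin
      act annihilator (A 1) u x
        ≈⟨ act-times-t-minus k (partial n) (A 1) u x ⟩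
      (A 1 ▹ act (partial n) (A 1) u) x - k * act (partial n) (A 1) u x
        ≈⟨ +-cong (▹-cong (A 1) (act-partial-diam u) x) (-‿cong (*-congˡ (act-partial-diam u x))) ⟩
      (A 1 ▹ (λ _ → sum u * 1#)) x - k * (sum u * 1#)
        ≈⟨ +-congʳ (Eigen-scale (sum u) A₁-rows x) ⟩
      k * (sum u * 1#) - k * (sum u * 1#)
        ≈⟨ -‿inverseʳ _ ⟩
      0# ∎
      where k = fromℕ degree

    annihilator-root : ∀ {t} → IsEigenvalue (A 1) t → eval annihilator t ≈ 0#
    annihilator-root {t} (w , (x , wx#0) , eigen) = x*y≈0∧x≉0⇒y≈0 (begin
      w x * eval annihilator t  ≈⟨ *-comm _ _ ⟩
      eval annihilator t * w x  ≈⟨ act-eigen annihilator eigen x ⟨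
      act annihilator (A 1) w x ≈⟨ act-annihilator w x ⟩
      0#                        ∎) (λ wx≈0 → proj₂ (tight (w x) 0#) wx≈0 wx#0)

    -- Eigenvalues and row sums

    module _ (θ : Fin (suc n) → Carrier) (spectrum : DistinctEigenvalues (A 1) θ) where
      open DistinctEigenvalues spectrum

      θ-eigenvalue : ∀ j → IsEigenvalue (A 1) (θ j)
      θ-eigenvalue j = Equivalence.from (eigenvalues (θ j)) (j , refl)

      θ# : ∀ {i j} → i Fin.< j → θ j # θ i
      θ# i<j = <⇒# (decreasing i<j)

      -- The vector `𝟏` makes the degree an eigenvalue, hence some θⱼ. If j were positive, θ₀ would
      -- exceed the row sum of A₁.
      θ₀≈degree : θ Fin.zero ≈ fromℕ degree
      θ₀≈degree with Equivalence.to (eigenvalues (fromℕ degree))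
                       (𝟏 , (proj₁ (∃-adjacent G conn 1≤n) , 1#0) , A₁-rows)
      ... | Fin.zero , k≈θ₀ = sym k≈θ₀
      ... | Fin.suc j , k≈θⱼ with θ-eigenvalue Fin.zero
      ...   | w , (x , wx#0) , eigen = ⊥-elim (eigenvalue≤rowSum (A-sym 1) (0≤A 1) A₁-rows eigen wx#0
                (x<y⇒x-y<0 (<-respˡ (sym k≈θⱼ) (decreasing (ℕ.s≤s ℕ.z≤n)))))

      -- So v_i(θ₀) is the number of vertices at distance i from any vertex, which is how v₁(θ₀) and
      -- v_n(θ₀) enter the final count of pairs.
      A-rows : ∀ {i} → i ℕ.≤ n → Eigen (A i) (eval (v i) (θ Fin.zero)) 𝟏
      A-rows i≤n = A-eigen i≤n (λ x → trans (A₁-rows x) (*-congʳ (sym θ₀≈degree)))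

      -- Both sides are the row sum of A₁ at one vertex, so the coefficients of `v 1` need not be
      -- determined. This makes the denominator of the bound positive.
      v₁θ₀≈degree : eval (v 1) (θ Fin.zero) ≈ fromℕ degree
      v₁θ₀≈degree = begin
        eval (v 1) (θ Fin.zero)      ≈⟨ *-identityʳ _ ⟨
        eval (v 1) (θ Fin.zero) * 1# ≈⟨ A-rows 1≤n x ⟨
        (A 1 ▹ 𝟏) x                  ≈⟨ A₁-rows x ⟩
        fromℕ degree * 1#            ≈⟨ *-identityʳ _ ⟩
        fromℕ degree                 ∎
        where x = proj₁ (∃-adjacent G conn 1≤n)

      A-gap : ∀ {i} → i ℕ.≤ n → ∀ j → 0# ≤ eval (v i) (θ Fin.zero) - eval (v i) (θ j)
      A-gap {i} i≤n j with θ-eigenvalue j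
      ... | w , (x , wx#0) , eigen = eigenvalue≤rowSum (A-sym i) (0≤A i) (A-rows i≤n) (A-eigen i≤n eigen) wx#0

      decomposition : ∀ u → Decomposes (A 1) θ u
      decomposition u = decompose (A 1) annihilator annihilator-degree θ θ#
        (annihilator-root ∘ θ-eigenvalue) u (act-annihilator u)

      -- The signed weights and the distortion bound

      module _ (μ : Carrier) (isMin : IsMinimum (Ratio n v θ) μ) where

        K : ℕ → Carrier
        K i = eval (v i) (θ Fin.zero)

        gap : ℕ → Fin (suc n) → Carrier
        gap i j = K i - eval (v i) (θ j)

        -- The minimum is attained at some j, where the denominator is apart from zero and
        -- nonnegative, hence positive, and the numerator is nonnegative. The sign of μ lets lower
        -- bounds on far pairs be multiplied by it.
        0≤μ : 0# ≤ μ
        0≤μ with proj₁ isMin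
        ... | j , den#0 , μ≈ with #⇒<⊎> den#0
        ...   | inj₁ den<0 = ⊥-elim (A-gap ℕ.≤-refl (Fin.suc j) den<0)
        ...   | inj₂ 0<den = 0<x∧0≤x*y⇒0≤y 0<den
                (≤-respʳ (sym (trans (*-congˡ μ≈) (quotient-cancel _ _ den#0))) (A-gap 1≤n (Fin.suc j)))

        -- These are the eigenvalues of the Laplacian of `W`. At θ₀ both gaps vanish; at a positive
        -- denominator, minimality of μ is multiplied out.
        0≤gap₁-μ*gapₙ : ∀ j → 0# ≤ gap 1 j - μ * gap n j
        0≤gap₁-μ*gapₙ Fin.zero = ≤-respʳ (sym (trans
          (solve 3 (λ a m b → (a :- a) :- m :* (b :- b) := a :- a) refl (K 1) μ (K n)) (-‿inverseʳ (K 1)))) ≤-refl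
        0≤gap₁-μ*gapₙ j@(Fin.suc j′) <0 = by-trichotomy 0# (gap n j)
          (λ 0<den → let den#0 = #-sym (<⇒# 0<den) in
            ≤-respʳ (trans
              (solve 3 (λ g q m → g :* (q :- m) := g :* q :- m :* g) refl (gap n j) (quotient (gap 1 j) (gap n j) den#0) μ)
              (+-congʳ (quotient-cancel (gap 1 j) (gap n j) den#0)))
              (0≤x*y (<⇒≤ 0<den) (x≤y⇒0≤y-x (proj₂ isMin _ (j′ , den#0 , refl)))) <0)
          -- With a zero denominator there is no ratio to compare, and the claim reduces to
          -- `gap 1 j` being nonnegative.
          (λ 0≈den → A-gap 1≤n j (<-respˡ (begin
            gap 1 j - μ * gap n j ≈⟨ +-congˡ (-‿cong (trans (*-congˡ (sym 0≈den)) (zeroʳ μ))) ⟩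
            gap 1 j - 0#          ≈⟨ x-0≈x _ ⟩
            gap 1 j               ∎) <0))
          (A-gap ℕ.≤-refl j)

        -- Entries may be negative, so `0≤energy` does not apply and nonnegativity of the energy has
        -- to come from the spectrum.
        W : Matrix N
        W x y = A 1 x y - μ * A n x y

        W-sym : Symmetric W
        W-sym x y = +-cong (A-sym 1 x y) (-‿cong (*-congˡ (A-sym n x y)))

        W-eigen : ∀ {s t w} → Eigen (A 1) s w → Eigen (A n) t w → Eigen W (s - μ * t) w
        W-eigen {s} {t} {w} eigen₁ eigenₙ x = begin
          sum (λ y → (A 1 x y - μ * A n x y) * w y)
            ≈⟨ sum-cong (λ y → solve 4 (λ a m b w → (a :- m :* b) :* w := a :* w :- m :* (b :* w)) refl (A 1 x y) μ (A n x y) (w y)) ⟩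
          sum (λ y → A 1 x y * w y - μ * (A n x y * w y))
            ≈⟨ ∑-distrib-sub (λ y → A 1 x y * w y) (λ y → μ * (A n x y * w y)) ⟩
          (A 1 ▹ w) x - sum (λ y → μ * (A n x y * w y))
            ≈⟨ +-congˡ (-‿cong (*-distribˡ-sum μ (λ y → A n x y * w y))) ⟨
          (A 1 ▹ w) x - μ * (A n ▹ w) x
            ≈⟨ +-cong (eigen₁ x) (-‿cong (*-congˡ (eigenₙ x))) ⟩
          s * w x - μ * (t * w x)
            ≈⟨ solve 4 (λ s m t w → s :* w :- m :* (t :* w) := (s :- m :* t) :* w) refl s μ t (w x) ⟩
          (s - μ * t) * w x ∎

        0≤energy-W : ∀ u → 0# ≤ energy W u
        0≤energy-W u = 0≤energy-spectral (A-sym 1) θ# (decomposition u) W-sym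
          (W-eigen (A-rows 1≤n) (A-rows ℕ.≤-refl))
          (λ j w eigen → W-eigen (A-eigen 1≤n eigen) (A-eigen ℕ.≤-refl eigen))
          (λ j → ≤-respʳ (solve 5 (λ a b m e f → (a :- b) :- m :* (e :- f) := (a :- m :* e) :- (b :- m :* f)) refl
            (K 1) (eval (v 1) (θ j)) μ (K n) (eval (v n) (θ j))) (0≤gap₁-μ*gapₙ j))

        -- Every row of `bound` has this number as its sum, so the double sum consists of N equal
        -- terms. It is nonnegative because, entry by entry, `bound` is `W` times the squared
        -- distance `R`, plus `slack`.
        μn²Kₙ≤K₁D² : ∀ D → EmbedsWithDistortion (λ x y → fromℕ (d x y)) D →
                     0# ≤ K 1 * D ^ 2 - μ * (K n * fromℕ n ^ 2)
        μn²Kₙ≤K₁D² D (ϱ , ϱ-bounds) = 0≤sum-replicate⇒0≤ (proj₁ (∃-adjacent G conn 1≤n))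
          (≤-respʳ (sum-cong row-total) (≤-respʳ regroup (0≤x+y 0≤ΣWR 0≤Σslack)))
          where
          R : Matrix N
          R x y = sum λ i → (ϱ x i - ϱ y i) ^ 2

          bound : Matrix N
          bound x y = A 1 x y * D ^ 2 - μ * (A n x y * fromℕ n ^ 2)

          -- The amounts by which the embedding beats its two constraints: images of adjacent
          -- vertices are at most D apart, those of vertices at distance n at least n.
          slack : Matrix N
          slack x y = A 1 x y * (D ^ 2 - R x y) + μ * (A n x y * (R x y - fromℕ n ^ 2))

          adjacent-bound : ∀ x y → d x y ≡ 1 → 0# ≤ D ^ 2 - R x y
          adjacent-bound x y xy≡1 with ϱ-bounds x y
          ... | r , (0≤r , r²≈) , _ , r≤Dd = ≤-respʳ (+-congˡ (-‿cong r²≈)) (x≤y⇒0≤y-x (^2-mono-≤ 0≤r (≤-respʳ (begin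
            D * fromℕ (d x y) ≡⟨ ≡.cong (λ k → D * fromℕ k) xy≡1 ⟩
            D * (1# + 0#)     ≈⟨ *-congˡ (+-identityʳ 1#) ⟩
            D * 1#            ≈⟨ *-identityʳ D ⟩
            D                 ∎) r≤Dd)))

          antipodal-bound : ∀ x y → d x y ≡ n → 0# ≤ R x y - fromℕ n ^ 2
          antipodal-bound x y xy≡n with ϱ-bounds x y
          ... | r , (0≤r , r²≈) , d≤r , _ = ≤-respʳ (+-congʳ r²≈) (x≤y⇒0≤y-x (^2-mono-≤ (0≤fromℕ n)
            (≡.subst (λ k → fromℕ k ≤ r) xy≡n d≤r)))

          0≤Σslack : 0# ≤ sum λ x → sum λ y → slack x y
          0≤Σslack = 0≤sum λ x → 0≤sum λ y → 0≤x+y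
            (0≤indicator* (d x y ℕ.≟ 1) (adjacent-bound x y))
            (0≤x*y 0≤μ (0≤indicator* (d x y ℕ.≟ n) (antipodal-bound x y)))

          -- The squared norm is a sum over coordinates, so after exchanging sums this is the sum of
          -- the energies of the coordinate functions of `ϱ`.
          0≤ΣWR : 0# ≤ sum λ x → sum λ y → W x y * R x y
          0≤ΣWR = ≤-respʳ (begin
            sum (λ i → sum λ x → sum λ y → W x y * (ϱ x i - ϱ y i) ^ 2)
              ≈⟨ ∑-comm (λ i x → sum λ y → W x y * (ϱ x i - ϱ y i) ^ 2) ⟩
            sum (λ x → sum λ i → sum λ y → W x y * (ϱ x i - ϱ y i) ^ 2)
              ≈⟨ sum-cong (λ x → ∑-comm (λ i y → W x y * (ϱ x i - ϱ y i) ^ 2)) ⟩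
            sum (λ x → sum λ y → sum λ i → W x y * (ϱ x i - ϱ y i) ^ 2)
              ≈⟨ sum-cong (λ x → sum-cong λ y → *-distribˡ-sum (W x y) (λ i → (ϱ x i - ϱ y i) ^ 2)) ⟨
            sum (λ x → sum λ y → W x y * R x y) ∎)
            (0≤sum λ i → 0≤energy-W (λ x → ϱ x i))

          regroup : sum (λ x → sum λ y → W x y * R x y) + sum (λ x → sum λ y → slack x y) ≈
                    sum (λ x → sum λ y → bound x y)
          regroup = begin
            sum (λ x → sum λ y → W x y * R x y) + sum (λ x → sum λ y → slack x y)
              ≈⟨ ∑-distrib-+ (λ x → sum λ y → W x y * R x y) (λ x → sum λ y → slack x y) ⟨
            sum (λ x → sum (λ y → W x y * R x y) + sum (λ y → slack x y))
              ≈⟨ sum-cong (λ x → ∑-distrib-+ (λ y → W x y * R x y) (slack x)) ⟨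
            sum (λ x → sum λ y → W x y * R x y + slack x y)
              ≈⟨ sum-cong (λ x → sum-cong λ y → solve 6 (λ a m b r e f →
                   (a :- m :* b) :* r :+ (a :* (e :- r) :+ m :* (b :* (r :- f))) := a :* e :- m :* (b :* f)) refl
                   (A 1 x y) μ (A n x y) (R x y) (D ^ 2) (fromℕ n ^ 2)) ⟩
            sum (λ x → sum λ y → bound x y) ∎

          row-sum : ∀ {i} → i ℕ.≤ n → ∀ z x → sum (λ y → A i x y * z) ≈ K i * z
          row-sum {i} i≤n z x = begin
            sum (λ y → A i x y * z)      ≈⟨ sum-cong {N} (λ y → *-congʳ (*-identityʳ _)) ⟨
            sum (λ y → A i x y * 1# * z) ≈⟨ *-distribʳ-sum z (λ y → A i x y * 1#) ⟨
            (A i ▹ 𝟏) x * z              ≈⟨ *-congʳ (trans (A-rows i≤n x) (*-identityʳ _)) ⟩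
            K i * z                      ∎

          row-total : ∀ x → sum (λ y → bound x y) ≈ K 1 * D ^ 2 - μ * (K n * fromℕ n ^ 2)
          row-total x = begin
            sum (λ y → bound x y)
              ≈⟨ ∑-distrib-sub (λ y → A 1 x y * D ^ 2) (λ y → μ * (A n x y * fromℕ n ^ 2)) ⟩
            sum (λ y → A 1 x y * D ^ 2) - sum (λ y → μ * (A n x y * fromℕ n ^ 2))
              ≈⟨ +-congˡ (-‿cong (*-distribˡ-sum μ (λ y → A n x y * fromℕ n ^ 2))) ⟨
            sum (λ y → A 1 x y * D ^ 2) - μ * sum (λ y → A n x y * fromℕ n ^ 2)
              ≈⟨ +-cong (row-sum 1≤n (D ^ 2) x) (-‿cong (*-congˡ (row-sum ℕ.≤-refl (fromℕ n ^ 2) x))) ⟩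
            K 1 * D ^ 2 - μ * (K n * fromℕ n ^ 2) ∎

        -- Multiplying by the positive number `K 1` clears the quotient and leaves the preceding
        -- inequality.
        distortion-bound : ∀ D → EmbedsWithDistortion (λ x y → fromℕ (d x y)) D →
          Σ (K 1 # 0#) λ K₁#0 → quotient (fromℕ n ^ 2 * K n) (K 1) K₁#0 * μ ≤ D ^ 2
        distortion-bound D embeds = K₁#0 , 0≤y-x⇒x≤y (0<x∧0≤x*y⇒0≤y 0<K₁ (≤-respʳ (sym (begin
          K 1 * (D ^ 2 - Q * μ)                 ≈⟨ solve 4 (λ k e q m → k :* (e :- q :* m) := k :* e :- m :* (k :* q)) refl (K 1) (D ^ 2) Q μ ⟩
          K 1 * D ^ 2 - μ * (K 1 * Q)           ≈⟨ +-congˡ (-‿cong (*-congˡ (trans (quotient-cancel _ _ K₁#0) (*-comm _ _)))) ⟩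
          K 1 * D ^ 2 - μ * (K n * fromℕ n ^ 2) ∎)) (μn²Kₙ≤K₁D² D embeds)))
          where
          0<K₁ : 0# < K 1
          0<K₁ = <-respʳ (sym v₁θ₀≈degree) 0<degree

          K₁#0 : K 1 # 0#
          K₁#0 = #-sym (<⇒# 0<K₁)

          Q = quotient (fromℕ n ^ 2 * K n) (K 1) K₁#0

theorem2p4 : ∀ {c ℓ₁ ℓ₂} (ℝ : Reals c ℓ₁ ℓ₂) → let open OverReals ℝ in
    ∀ {N} (G : Graph N) (conn : Connected G) → DistanceRegular G conn →
    let n = diam G conn in 1 ℕ.≤ n →
    (θ : Fin (suc n) → Carrier) → DistinctEigenvalues (distanceMatrix G conn 1) θ →
    (v : ∀ i → Poly i) → IsDistancePolynomials G conn v →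
    ∀ c₂ → Is-c₂ G conn c₂ →
    ∀ μ → IsMinimum (Ratio n v θ) μ →
    Σ (eval (v 1) (θ Fin.zero) # 0#) λ v₁θ₀#0 →
    quotient (fromℕ n ^ 2 * eval (v n) (θ Fin.zero)) (eval (v 1) (θ Fin.zero)) v₁θ₀#0 * μ ≤ c₂ ^ 2
theorem2p4 ℝ G conn regular 1≤n θ spectrum v isDP c₂ isLeast μ isMin =
  DistanceRegularSpectrum.distortion-bound ℝ G conn regular 1≤n v isDP θ spectrum μ isMin c₂ (proj₁ isLeast)
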